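{- Let $G$ be a connected graph with two distinct marked vertices $x,y$, and for $n\ge 3$ let $F_n(G)=F_n(G,x,y)$ be the generalized flower graph. Let $M_n=\max_{u,v\in V(F_n(G))} r_{F_n(G)}(u,v)$ be the largest effective resistance between two vertices of $F_n(G)$. Then $$\lim_{n\to\infty}\left[M_{n+1}-M_n\right]=\tfrac14\, r_G(x,y).$$
   Context: For a connected graph $H$ with vertex set $\{1,\dots,N\}$ and Laplacian matrix $L$, the resistance distance (effective resistance) between vertices $i,j$ is $r_H(i,j)=(e_i-e_j)^T L^\dagger (e_i-e_j)$, where $e_i$ is the $i$th standard unit vector and $L^\dagger$ is the Moore–Penrose pseudoinverse of $L$. Generalized flower graph: let $G$ be a graph, $x\ne y$ two vertices of $G$, and $n\ge 3$. $F_n(G,x,y)$ (written $F_n(G)$) is the graph obtained by taking $n$ vertex-disjoint copies $G_1,\dots,G_n$ of $G$ (the petals), with $x_i,y_i$ the copies of $x,y$ in $G_i$, and identifying $y_i$ with $x_{i+1}$ for $1\le i<n$ and $y_n$ with $x_1$. -}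

module Defs where

open import Algebra.Bundles using (CommutativeRing)
open import Data.Bool.Base using (if_then_else_)
open import Data.Empty using (⊥; ⊥-elim)
open import Data.Fin.Base using (Fin; zero; suc; toℕ; combine; punchIn; punchOut)
open import Data.Fin.Properties as Fin
  using (any?; toℕ-fromℕ<; toℕ-injective; toℕ<n; combine-injective; combine-surjective;
         punchOut-injective; punchOut-cong; punchOut-punchIn; punchInᵢ≢i)
open import Data.List.Base using (List; allFin; cartesianProductWith)
open import Data.List.Membership.Propositional.Properties
  using (∈-allFin; ∈-cartesianProductWith⁺; ∈-cartesianProductWith⁻)
open import Data.List.Relation.Unary.All using (lookup)
open import Data.Nat.Base as ℕ using (ℕ; zero; suc)
open import Data.Nat.DivMod using (_mod_; m<n⇒m%n≡m; n%n≡0)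
import Data.Nat.Properties as ℕ
open import Data.Product using (Σ; ∃; ∃₂; _×_; _,_; proj₁; proj₂)
open import Data.Rational.Base
  using (ℚ; 0ℚ; 1ℚ; _+_; _*_; _-_; -_; _≤_; _<_; ∣_∣; 1/_; ≢-nonZero; nonNegative; nonPositive)
open import Data.Rational.Properties as ℚ
  using (+-*-commutativeRing; ≤-decTotalOrder)
open import Data.Rational.Solver using (module +-*-Solver)
open import Data.Sum.Base using (_⊎_; inj₁; inj₂)
open import Data.Vec.Functional using (Vector)
open import Function.Base using (_∘_; id)
open import Level using (0ℓ)
open import Relation.Binary.Bundles using (DecTotalOrder)
open import Relation.Binary.Core using (Rel)
open import Relation.Binary.Construct.Closure.ReflexiveTransitive using (Star)
open import Relation.Binary.Definitions using (Decidable; Symmetric; Irreflexive)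
open import Relation.Binary.PropositionalEquality
open import Relation.Nullary using (yes; no; does)
open import Relation.Nullary.Decidable using (_×-dec_)

open import Algebra.Properties.Semiring.Sum
  (CommutativeRing.semiring +-*-commutativeRing)
  using (sum; sum-syntax; sum-cong-≗; sum-replicate-zero; ∑-distrib-+; ∑-comm;
         *-distribˡ-sum; *-distribʳ-sum)
open import Data.List.Extrema (DecTotalOrder.totalOrder ≤-decTotalOrder) using (max; argmax-sel; xs≤max)

open ≡-Reasoning

Matrix : ℕ → ℕ → Set
Matrix m n = Fin m → Fin n → ℚ

infixl 8 _ᵀ
infixl 7 _·_ _·ᵥ_ _∙_
infix  4 _≐_

_≐_ : ∀ {m n} → Rel (Matrix m n) 0ℓ
A ≐ B = ∀ i j → A i j ≡ B i j

_ᵀ : ∀ {m n} → Matrix m n → Matrix n m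
(A ᵀ) i j = A j i

_∙_ : ∀ {n} → Vector ℚ n → Vector ℚ n → ℚ
_∙_ {n} x y = ∑[ i < n ] (x i * y i)

_·ᵥ_ : ∀ {m n} → Matrix m n → Vector ℚ n → Vector ℚ m
(A ·ᵥ x) i = A i ∙ x

_·_ : ∀ {m n p} → Matrix m n → Matrix n p → Matrix m p
(A · B) i k = A i ∙ (B ᵀ) k

-- The Penrose conditions.  A rational matrix has a rational pseudoinverse
-- (see pseudoinverse below), which by uniqueness is also its pseudoinverse
-- over the reals, so all resistances are rational.
record IsMoorePenrose {m n} (A : Matrix m n) (X : Matrix n m) : Set where
  field
    AXA≐A  : A · X · A ≐ A
    XAX≐X  : X · A · X ≐ X
    AX-sym : (A · X) ᵀ ≐ A · X
    XA-sym : (X · A) ᵀ ≐ X · A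

≐-sym : ∀ {m n} {A B : Matrix m n} → A ≐ B → B ≐ A
≐-sym p i j = sym (p i j)

infixr 2 _⊙_
_⊙_ : ∀ {m n} {A B C : Matrix m n} → A ≐ B → B ≐ C → A ≐ C
(p ⊙ q) i j = trans (p i j) (q i j)

∙-cong : ∀ {n} {x x′ y y′ : Vector ℚ n} → x ≗ x′ → y ≗ y′ → x ∙ y ≡ x′ ∙ y′
∙-cong p q = sum-cong-≗ λ i → cong₂ _*_ (p i) (q i)

∙-congˡ : ∀ {n} (x : Vector ℚ n) {y y′ : Vector ℚ n} → y ≗ y′ → x ∙ y ≡ x ∙ y′
∙-congˡ x q = ∙-cong {x = x} (λ _ → refl) q

∙-comm : ∀ {n} (x y : Vector ℚ n) → x ∙ y ≡ y ∙ x
∙-comm x y = sum-cong-≗ λ i → ℚ.*-comm (x i) (y i)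

·-congˡ : ∀ {m n p} (A : Matrix m n) {B C : Matrix n p} → B ≐ C → A · B ≐ A · C
·-congˡ A p i k = ∙-congˡ (A i) (λ j → p j k)

·-congʳ : ∀ {m n p} {A B : Matrix m n} (C : Matrix n p) → A ≐ B → A · C ≐ B · C
·-congʳ C p i k = ∙-cong (p i) (λ _ → refl)

·ᵥ-adjoint : ∀ {m n} (A : Matrix m n) x y → x ∙ (A ·ᵥ y) ≡ (A ᵀ ·ᵥ x) ∙ y
·ᵥ-adjoint {m} {n} A x y = begin
  ∑[ i < m ] (x i * ∑[ j < n ] (A i j * y j))
    ≡⟨ sum-cong-≗ (λ i → *-distribˡ-sum (x i) (λ j → A i j * y j)) ⟩
  ∑[ i < m ] ∑[ j < n ] (x i * (A i j * y j))
    ≡⟨ ∑-comm (λ i j → x i * (A i j * y j)) ⟩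
  ∑[ j < n ] ∑[ i < m ] (x i * (A i j * y j))
    ≡⟨ sum-cong-≗ (λ j → sum-cong-≗ λ i →
         solve 3 (λ a b c → a :* (b :* c) := b :* a :* c) refl (x i) (A i j) (y j)) ⟩
  ∑[ j < n ] ∑[ i < m ] (A i j * x i * y j)
    ≡⟨ sum-cong-≗ (λ j → *-distribʳ-sum (y j) (λ i → A i j * x i)) ⟨
  ∑[ j < n ] (∑[ i < m ] (A i j * x i) * y j) ∎
  where open +-*-Solver

·-assoc : ∀ {m n p q} (A : Matrix m n) (B : Matrix n p) (C : Matrix p q) →
          A · B · C ≐ A · (B · C)
·-assoc A B C i k = begin
  (λ j → A i ∙ (B ᵀ) j) ∙ (C ᵀ) k   ≡⟨ ∙-cong (λ j → ∙-comm (A i) ((B ᵀ) j)) (λ _ → refl) ⟩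
  (B ᵀ ·ᵥ A i) ∙ (C ᵀ) k            ≡⟨ ·ᵥ-adjoint B (A i) ((C ᵀ) k) ⟨
  A i ∙ (B ·ᵥ (C ᵀ) k)              ∎

ᵀ-· : ∀ {m n p} (A : Matrix m n) (B : Matrix n p) → (A · B) ᵀ ≐ B ᵀ · A ᵀ
ᵀ-· A B i k = ∙-comm (A k) ((B ᵀ) i)

∙-distrib-+ : ∀ {n} (x y z : Vector ℚ n) → x ∙ (λ i → y i + z i) ≡ x ∙ y + x ∙ z
∙-distrib-+ x y z = trans
  (sum-cong-≗ λ i → ℚ.*-distribˡ-+ (x i) (y i) (z i))
  (∑-distrib-+ (λ i → x i * y i) (λ i → x i * z i))

∙-scale : ∀ {n} (x y : Vector ℚ n) s → x ∙ (λ i → y i * s) ≡ x ∙ y * s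
∙-scale x y s = trans
  (sum-cong-≗ λ i → sym (ℚ.*-assoc (x i) (y i) s))
  (sym (*-distribʳ-sum s (λ i → x i * y i)))

0∙ : ∀ {n} (x y : Vector ℚ n) → (∀ i → x i ≡ 0ℚ) → x ∙ y ≡ 0ℚ
0∙ {n} x y x≡0 = trans
  (sum-cong-≗ λ i → trans (cong (_* y i) (x≡0 i)) (ℚ.*-zeroˡ (y i)))
  (sum-replicate-zero n)

square-nonneg : ∀ p → 0ℚ ≤ p * p
square-nonneg p with ℚ.≤-total 0ℚ p
... | inj₁ 0≤p = subst (_≤ p * p) (ℚ.*-zeroˡ p)
      (ℚ.*-monoʳ-≤-nonNeg p {{nonNegative 0≤p}} 0≤p)
... | inj₂ p≤0 = subst (_≤ p * p) (ℚ.*-zeroˡ p)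
      (ℚ.*-monoʳ-≤-nonPos p {{nonPositive p≤0}} p≤0)

square≡0 : ∀ p → p * p ≡ 0ℚ → p ≡ 0ℚ
square≡0 p p²≡0 with p ℚ.≟ 0ℚ
... | yes p≡0 = p≡0
... | no  p≢0 = begin
  p                                 ≡⟨ ℚ.*-identityˡ p ⟨
  1ℚ * p                            ≡⟨ cong (_* p) (ℚ.*-inverseˡ p {{nz}}) ⟨
  (1/ p) {{nz}} * p * p             ≡⟨ ℚ.*-assoc ((1/ p) {{nz}}) p p ⟩
  (1/ p) {{nz}} * (p * p)           ≡⟨ cong ((1/ p) {{nz}} *_) p²≡0 ⟩
  (1/ p) {{nz}} * 0ℚ                ≡⟨ ℚ.*-zeroʳ ((1/ p) {{nz}}) ⟩
  0ℚ                                ∎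
  where nz = ≢-nonZero p≢0

sum-nonneg≡0 : ∀ p q → 0ℚ ≤ p → 0ℚ ≤ q → p + q ≡ 0ℚ → p ≡ 0ℚ × q ≡ 0ℚ
sum-nonneg≡0 p q 0≤p 0≤q p+q≡0 =
  ℚ.≤-antisym (subst₂ _≤_ (ℚ.+-identityʳ p) p+q≡0 (ℚ.+-monoʳ-≤ p 0≤q)) 0≤p ,
  ℚ.≤-antisym (subst₂ _≤_ (ℚ.+-identityˡ q) p+q≡0 (ℚ.+-monoˡ-≤ q 0≤p)) 0≤q

norm-nonneg : ∀ {n} (x : Vector ℚ n) → 0ℚ ≤ x ∙ x
norm-nonneg {zero}  x = ℚ.≤-refl
norm-nonneg {suc n} x = ℚ.+-mono-≤ (square-nonneg (x zero)) (norm-nonneg (x ∘ suc))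

norm≡0 : ∀ {n} (x : Vector ℚ n) → x ∙ x ≡ 0ℚ → ∀ i → x i ≡ 0ℚ
norm≡0 {suc n} x x∙x≡0 i
  with p , q ← sum-nonneg≡0 (x zero * x zero) ((x ∘ suc) ∙ (x ∘ suc))
                 (square-nonneg (x zero)) (norm-nonneg (x ∘ suc)) x∙x≡0
  with i
... | zero  = square≡0 (x zero) p
... | suc j = norm≡0 (x ∘ suc) q j

-- A least-squares inverse: A · Y is the orthogonal projection onto the
-- column space of A.
record LeastSquares {m n} (A : Matrix m n) : Set where
  field
    Y      : Matrix n m
    AYA≐A  : A · Y · A ≐ A
    AY-sym : (A · Y) ᵀ ≐ A · Y

-- Recursion on columns.  With a the first column, B the others and c the
-- component of a orthogonal to the columns of B, the projection grows by
-- c cᵀ / (c ∙ c), or not at all if c vanishes.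
leastSquares : ∀ {m n} (A : Matrix m n) → LeastSquares A
leastSquares {m} {zero}  A = record
  { Y = λ () ; AYA≐A = λ _ () ; AY-sym = λ _ _ → refl }
leastSquares {m} {suc n} A = record
  { Y = Y′ ; AYA≐A = AYA ; AY-sym = AYsym }
  where
  open +-*-Solver
  a : Vector ℚ m
  a i = A i zero

  B : Matrix m n
  B i j = A i (suc j)

  open LeastSquares (leastSquares B)
    renaming (AYA≐A to BYB≐B; AY-sym to BY-sym)

  d : Vector ℚ n
  d = Y ·ᵥ a

  c : Vector ℚ m
  c i = a i - (B ·ᵥ d) i

  weight : Σ ℚ λ w → ∀ i → c i * (w * (c ∙ c)) ≡ c i
  weight with c ∙ c ℚ.≟ 0ℚ
  ... | yes c∙c≡0 = 0ℚ , λ i → trans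
          (cong (_* (0ℚ * (c ∙ c))) (norm≡0 c c∙c≡0 i))
          (trans (ℚ.*-zeroˡ (0ℚ * (c ∙ c))) (sym (norm≡0 c c∙c≡0 i)))
  ... | no  c∙c≢0 = (1/ (c ∙ c)) {{≢-nonZero c∙c≢0}} , λ i → trans
          (cong (c i *_) (ℚ.*-inverseˡ (c ∙ c) {{≢-nonZero c∙c≢0}}))
          (ℚ.*-identityʳ (c i))

  w : ℚ
  w = proj₁ weight

  b : Vector ℚ m
  b k = c k * w

  Y′ : Matrix (suc n) m
  Y′ zero    k = b k
  Y′ (suc j) k = Y j k - d j * b k

  P : Matrix m m
  P = B · Y

  AY′ : ∀ i k → (A · Y′) i k ≡ P i k + c i * b k
  AY′ i k = begin
    a i * b k + B i ∙ (λ j → Y j k - d j * b k)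
      ≡⟨ cong (a i * b k +_) (∙-congˡ (B i) λ j →
           solve 3 (λ y e f → y :+ :- (e :* f) := y :+ e :* (:- f)) refl (Y j k) (d j) (b k)) ⟩
    a i * b k + B i ∙ (λ j → Y j k + d j * (- b k))
      ≡⟨ cong (a i * b k +_) (∙-distrib-+ (B i) ((Y ᵀ) k) (λ j → d j * (- b k))) ⟩
    a i * b k + (P i k + B i ∙ (λ j → d j * (- b k)))
      ≡⟨ cong (λ t → a i * b k + (P i k + t)) (∙-scale (B i) d (- b k)) ⟩
    a i * b k + (P i k + (B ·ᵥ d) i * (- b k))
      ≡⟨ solve 4 (λ x y p e → x :* y :+ (p :+ e :* (:- y)) := p :+ (x :+ :- e) :* y) refl
           (a i) (b k) (P i k) ((B ·ᵥ d) i) ⟩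
    P i k + c i * b k ∎

  BᵀP : B ᵀ · P ≐ B ᵀ
  BᵀP = ·-congˡ (B ᵀ) (≐-sym BY-sym) ⊙ ≐-sym (ᵀ-· P B) ⊙ λ i j → BYB≐B j i

  Pa : ∀ i → (P ·ᵥ a) i ≡ (B ·ᵥ d) i
  Pa i = ·-assoc B Y (λ k (_ : Fin 1) → a k) i zero

  Bᵀc : ∀ j → (B ᵀ) j ∙ c ≡ 0ℚ
  Bᵀc j = begin
    (B ᵀ) j ∙ c
      ≡⟨ ∙-congˡ ((B ᵀ) j) (λ i → cong (a i +_)
           (solve 1 (λ x → :- x := x :* con (- 1ℚ)) refl ((B ·ᵥ d) i))) ⟩
    (B ᵀ) j ∙ (λ i → a i + (B ·ᵥ d) i * (- 1ℚ))
      ≡⟨ ∙-distrib-+ ((B ᵀ) j) a (λ i → (B ·ᵥ d) i * (- 1ℚ)) ⟩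
    (B ᵀ) j ∙ a + (B ᵀ) j ∙ (λ i → (B ·ᵥ d) i * (- 1ℚ))
      ≡⟨ cong ((B ᵀ) j ∙ a +_) (∙-scale ((B ᵀ) j) (B ·ᵥ d) (- 1ℚ)) ⟩
    (B ᵀ) j ∙ a + (B ᵀ) j ∙ (B ·ᵥ d) * (- 1ℚ)
      ≡⟨ cong (λ t → (B ᵀ) j ∙ a + t * (- 1ℚ)) (begin
           (B ᵀ) j ∙ (B ·ᵥ d)   ≡⟨ ∙-congˡ ((B ᵀ) j) Pa ⟨
           (B ᵀ) j ∙ (P ·ᵥ a)   ≡⟨ ·-assoc (B ᵀ) P (λ k (_ : Fin 1) → a k) j zero ⟨
           (B ᵀ · P) j ∙ a      ≡⟨ ∙-cong (BᵀP j) (λ _ → refl) ⟩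
           (B ᵀ) j ∙ a          ∎) ⟩
    (B ᵀ) j ∙ a + (B ᵀ) j ∙ a * (- 1ℚ)
      ≡⟨ solve 1 (λ x → x :+ x :* con (- 1ℚ) := con 0ℚ) refl ((B ᵀ) j ∙ a) ⟩
    0ℚ ∎

  c∙a : c ∙ a ≡ c ∙ c
  c∙a = begin
    c ∙ a                      ≡⟨ ∙-congˡ c (λ i →
                                    solve 2 (λ x y → x := x :+ :- y :+ y) refl (a i) ((B ·ᵥ d) i)) ⟩
    c ∙ (λ i → c i + (B ·ᵥ d) i) ≡⟨ ∙-distrib-+ c c (B ·ᵥ d) ⟩
    c ∙ c + c ∙ (B ·ᵥ d)       ≡⟨ cong (c ∙ c +_) (·ᵥ-adjoint B c d) ⟩
    c ∙ c + (B ᵀ ·ᵥ c) ∙ d     ≡⟨ cong (c ∙ c +_) (0∙ (B ᵀ ·ᵥ c) d Bᵀc) ⟩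
    c ∙ c + 0ℚ                 ≡⟨ ℚ.+-identityʳ (c ∙ c) ⟩
    c ∙ c                      ∎

  project : ∀ i (v : Vector ℚ m) → (A · Y′) i ∙ v ≡ P i ∙ v + c i * (w * (c ∙ v))
  project i v = begin
    (A · Y′) i ∙ v
      ≡⟨ ∙-cong (AY′ i) (λ _ → refl) ⟩
    (λ k → P i k + c i * b k) ∙ v
      ≡⟨ ∙-comm (λ k → P i k + c i * b k) v ⟩
    v ∙ (λ k → P i k + c i * b k)
      ≡⟨ ∙-congˡ v (λ k → cong (P i k +_)
           (solve 3 (λ x y z → x :* (y :* z) := y :* (x :* z)) refl (c i) (c k) w)) ⟩
    v ∙ (λ k → P i k + c k * (c i * w))
      ≡⟨ ∙-distrib-+ v (P i) (λ k → c k * (c i * w)) ⟩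
    v ∙ P i + v ∙ (λ k → c k * (c i * w))
      ≡⟨ cong (v ∙ P i +_) (∙-scale v c (c i * w)) ⟩
    v ∙ P i + v ∙ c * (c i * w)
      ≡⟨ cong₂ (λ s t → s + t * (c i * w)) (∙-comm v (P i)) (∙-comm v c) ⟩
    P i ∙ v + c ∙ v * (c i * w)
      ≡⟨ cong (P i ∙ v +_) (solve 3 (λ x y z → x :* (y :* z) := y :* (z :* x)) refl
           (c ∙ v) (c i) w) ⟩
    P i ∙ v + c i * (w * (c ∙ v)) ∎

  AYA : A · Y′ · A ≐ A
  AYA i zero = begin
    (A · Y′) i ∙ a                     ≡⟨ project i a ⟩
    P i ∙ a + c i * (w * (c ∙ a))      ≡⟨ cong₂ (λ s t → s + c i * (w * t)) (Pa i) c∙a ⟩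
    (B ·ᵥ d) i + c i * (w * (c ∙ c))   ≡⟨ cong ((B ·ᵥ d) i +_) (proj₂ weight i) ⟩
    (B ·ᵥ d) i + c i                   ≡⟨ solve 2 (λ x y → y :+ (x :+ :- y) := x) refl
                                            (a i) ((B ·ᵥ d) i) ⟩
    a i                                ∎
  AYA i (suc j) = begin
    (A · Y′) i ∙ (B ᵀ) j                     ≡⟨ project i ((B ᵀ) j) ⟩
    P i ∙ (B ᵀ) j + c i * (w * (c ∙ (B ᵀ) j))
      ≡⟨ cong₂ (λ s t → s + c i * (w * t)) (BYB≐B i j) (trans (∙-comm c ((B ᵀ) j)) (Bᵀc j)) ⟩
    B i j + c i * (w * 0ℚ)
      ≡⟨ solve 3 (λ x y z → x :+ y :* (z :* con 0ℚ) := x) refl (B i j) (c i) w ⟩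
    B i j ∎

  AYsym : (A · Y′) ᵀ ≐ A · Y′
  AYsym i k = begin
    (A · Y′) k i        ≡⟨ AY′ k i ⟩
    P k i + c k * b i   ≡⟨ cong₂ _+_ (BY-sym i k)
                             (solve 3 (λ x y z → x :* (y :* z) := y :* (x :* z)) refl (c k) (c i) w) ⟩
    P i k + c i * b k   ≡⟨ AY′ i k ⟨
    (A · Y′) i k        ∎

-- A⁺ = Z A Y, where A Y and Z A are the orthogonal projections onto the
-- column space and the row space.
pseudoinverse : ∀ {m n} (A : Matrix m n) → Σ (Matrix n m) (IsMoorePenrose A)
pseudoinverse A = Z · A · Y , record
  { AXA≐A  = ·-congʳ A AX ⊙ AYA≐A
  ; XAX≐X  = ·-congʳ (Z · A · Y) XA ⊙ ≐-sym (·-assoc (Z · A) (Z · A) Y)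
             ⊙ ·-congʳ Y (≐-sym (·-assoc (Z · A) Z A)
                          ⊙ ·-congʳ A (·-assoc Z A Z)
                          ⊙ ·-assoc Z (A · Z) A
                          ⊙ ·-congˡ Z AZA)
  ; AX-sym = (λ i j → AX j i) ⊙ AY-sym ⊙ ≐-sym AX
  ; XA-sym = (λ i j → XA j i) ⊙ ZA-sym ⊙ ≐-sym XA
  }
  where
  open LeastSquares (leastSquares A)
  module R = LeastSquares (leastSquares (A ᵀ))

  Z = R.Y ᵀ

  ZA-sym : (Z · A) ᵀ ≐ Z · A
  ZA-sym i j = trans (∙-comm (Z j) ((A ᵀ) i)) (trans (R.AY-sym j i) (∙-comm ((A ᵀ) j) (Z i)))

  AZA : A · Z · A ≐ A
  AZA = ·-assoc A Z A ⊙ λ i j →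
    trans (∙-comm (A i) (((Z · A) ᵀ) j))
          (trans (∙-cong (ᵀ-· Z A j) (λ _ → refl)) (R.AYA≐A j i))

  AX : A · (Z · A · Y) ≐ A · Y
  AX = ≐-sym (·-assoc A (Z · A) Y) ⊙ ·-congʳ Y (≐-sym (·-assoc A Z A) ⊙ AZA)

  XA : Z · A · Y · A ≐ Z · A
  XA = ·-assoc (Z · A) Y A ⊙ ·-assoc Z A (Y · A) ⊙ ·-congˡ Z (≐-sym (·-assoc A Y A) ⊙ AYA≐A)

IsMoorePenrose-unique : ∀ {m n} {A : Matrix m n} {X Y : Matrix n m} →
                        IsMoorePenrose A X → IsMoorePenrose A Y → X ≐ Y
IsMoorePenrose-unique {A = A} {X} {Y} p q =
  ≐-sym p.XAX≐X ⊙ ·-assoc X A X ⊙ ·-congˡ X AX≐AY ⊙ ≐-sym (·-assoc X A Y)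
  ⊙ ·-congʳ Y XA≐YA ⊙ q.XAX≐X
  where
  module p = IsMoorePenrose p
  module q = IsMoorePenrose q

  AX≐AY : A · X ≐ A · Y
  AX≐AY = ≐-sym p.AX-sym ⊙ (λ i j → AX j i) ⊙ ᵀ-· (A · Y) (A · X)
    ⊙ ·-congʳ ((A · Y) ᵀ) p.AX-sym ⊙ ·-congˡ (A · X) q.AX-sym
    ⊙ ≐-sym (·-assoc (A · X) A Y) ⊙ ·-congʳ Y p.AXA≐A
    where
    AX : A · X ≐ (A · Y) · (A · X)
    AX = ·-congʳ X (≐-sym q.AXA≐A) ⊙ ·-assoc (A · Y) A X

  XA≐YA : X · A ≐ Y · A
  XA≐YA = ≐-sym p.XA-sym ⊙ (λ i j → XA j i) ⊙ ᵀ-· (X · A) (Y · A)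
    ⊙ ·-congʳ ((X · A) ᵀ) q.XA-sym ⊙ ·-congˡ (Y · A) p.XA-sym
    ⊙ ·-assoc Y A (X · A) ⊙ ·-congˡ Y (≐-sym (·-assoc A X A) ⊙ p.AXA≐A)
    where
    XA : X · A ≐ (X · A) · (Y · A)
    XA = ·-congˡ X (≐-sym q.AXA≐A ⊙ ·-assoc A Y A) ⊙ ≐-sym (·-assoc X A (Y · A))

_⁺ : ∀ {m n} → Matrix m n → Matrix n m
A ⁺ = proj₁ (pseudoinverse A)

record Graph (N : ℕ) : Set₁ where
  field
    Adj    : Rel (Fin N) 0ℓ
    adj?   : Decidable Adj
    symm   : Symmetric Adj
    irrefl : Irreflexive _≡_ Adj

Connected : ∀ {N} → Graph N → Set
Connected G = ∀ u v → Star (Graph.Adj G) u v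

e : ∀ {N} → Fin N → Vector ℚ N
e i j = if does (i Fin.≟ j) then 1ℚ else 0ℚ

module _ {N : ℕ} (G : Graph N) where
  open Graph G

  adjacency : Matrix N N
  adjacency u v = if does (adj? u v) then 1ℚ else 0ℚ

  degree : Fin N → ℚ
  degree u = ∑[ v < N ] adjacency u v

  laplacian : Matrix N N
  laplacian u v = degree u * e u v - adjacency u v

  resistance : Fin N → Fin N → ℚ
  resistance u v = d ∙ (laplacian ⁺ ·ᵥ d)
    where
    d : Vector ℚ N
    d i = e u i - e v i

  resistances : List ℚ
  resistances = cartesianProductWith resistance (allFin N) (allFin N)

  -- The default value 0 for the empty list is harmless, as it is the
  -- resistance between a vertex and itself.
  maxResistance : ℚ
  maxResistance = max 0ℚ resistances

  resistance-refl : ∀ u → resistance u u ≡ 0ℚ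
  resistance-refl u = 0∙ d (laplacian ⁺ ·ᵥ d) (λ i → ℚ.+-inverseʳ (e u i))
    where
    d : Vector ℚ N
    d i = e u i - e u i

  resistance≤max : ∀ u v → resistance u v ≤ maxResistance
  resistance≤max u v = lookup (xs≤max 0ℚ resistances)
    (∈-cartesianProductWith⁺ resistance (∈-allFin u) (∈-allFin v))

  max-attained : Fin N → ∃₂ λ u v → resistance u v ≡ maxResistance
  max-attained w with argmax-sel id 0ℚ resistances
  ... | inj₁ max≡0 = w , w , trans (resistance-refl w) (sym max≡0)
  ... | inj₂ max∈
    with u , v , _ , _ , max≡ ← ∈-cartesianProductWith⁻ resistance (allFin N) (allFin N) max∈
    = u , v , sym max≡

next : ∀ {n} → Fin n → Fin n
next {suc n} i = suc (toℕ i) mod suc n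

toℕ-next : ∀ {n} (i : Fin n) →
           toℕ (next i) ≡ suc (toℕ i) ⊎ (toℕ (next i) ≡ 0 × suc (toℕ i) ≡ n)
toℕ-next {suc n} i with ℕ.m≤n⇒m<n∨m≡n (toℕ<n i)
... | inj₁ i+1<n = inj₁ (trans (toℕ-fromℕ< _) (m<n⇒m%n≡m i+1<n))
... | inj₂ i+1≡n = inj₂
  (trans (toℕ-fromℕ< _) (trans (cong (ℕ._% suc n) i+1≡n) (n%n≡0 (suc n))) , i+1≡n)

next-injective : ∀ {n} {i j : Fin n} → next i ≡ next j → i ≡ j
next-injective {i = i} {j} eq with toℕ-next i | toℕ-next j
... | inj₁ p       | inj₁ q       = toℕ-injective
  (ℕ.suc-injective (trans (sym p) (trans (cong toℕ eq) q)))
... | inj₁ p       | inj₂ (q , _) with () ← trans (sym p) (trans (cong toℕ eq) q)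
... | inj₂ (p , _) | inj₁ q       with () ← trans (sym p) (trans (cong toℕ eq) q)
... | inj₂ (_ , p) | inj₂ (_ , q) = toℕ-injective (ℕ.suc-injective (trans p (sym q)))

next≢ : ∀ {n} → 2 ℕ.≤ n → (i : Fin n) → next i ≢ i
next≢ 2≤n i eq with toℕ-next i
... | inj₁ p       = ℕ.1+n≢n (trans (sym p) (cong toℕ eq))
... | inj₂ (p , q) = ℕ.<⇒≢ 2≤n
  (trans (cong suc (trans (sym p) (cong toℕ eq))) q)

-- The vertices of the flower are represented by the pairs (i , v) with v a
-- vertex of petal i other than y; such pairs are coded as elements of
-- Fin (n * k) by omitting y from Fin (suc k).  glue i sends each vertex of
-- petal i to its class in the flower, the class of y in petal i being
-- represented by x in petal i + 1 (cyclically).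
module _ {k n : ℕ} {x y : Fin (suc k)} (x≢y : x ≢ y) where

  glue : Fin n → Fin (suc k) → Fin (n ℕ.* k)
  glue i v with y Fin.≟ v
  ... | yes _   = combine (next i) (punchOut (x≢y ∘ sym))
  ... | no  y≢v = combine i (punchOut y≢v)

  glue-≢ : ∀ i {v} (y≢v : y ≢ v) → glue i v ≡ combine i (punchOut y≢v)
  glue-≢ i {v} y≢v with y Fin.≟ v
  ... | yes y≡v = ⊥-elim (y≢v y≡v)
  ... | no  _   = cong (combine i) (punchOut-cong y refl)

  glue-y : ∀ i → glue i y ≡ glue (next i) x
  glue-y i with y Fin.≟ y
  ... | yes _   = sym (glue-≢ (next i) (x≢y ∘ sym))
  ... | no  y≢y = ⊥-elim (y≢y refl)

  glue-surjective : ∀ p → ∃₂ λ i v → glue i v ≡ p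
  glue-surjective p with i , j , refl ← combine-surjective {n} {k} p =
    i , punchIn y j ,
    trans (glue-≢ i (punchInᵢ≢i y j ∘ sym)) (cong (combine {n} i) (punchOut-punchIn y))

  -- No vertices are identified other than those in glue-y.
  glue-kernel : ∀ {i j u v} → glue i u ≡ glue j v →
                (i ≡ j × u ≡ v)
                ⊎ (u ≡ y × v ≡ x × next i ≡ j)
                ⊎ (u ≡ x × v ≡ y × next j ≡ i)
  glue-kernel {i} {j} {u} {v} eq with y Fin.≟ u | y Fin.≟ v
  ... | yes refl | yes refl = inj₁
    (next-injective (proj₁ (combine-injective (next i) _ (next j) _ eq)) , refl)
  ... | yes refl | no y≢v with p , q ← combine-injective (next i) _ j _ eq =
    inj₂ (inj₁ (refl , sym (punchOut-injective (x≢y ∘ sym) y≢v q) , p))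
  ... | no y≢u | yes refl with p , q ← combine-injective i _ (next j) _ eq =
    inj₂ (inj₂ (punchOut-injective y≢u (x≢y ∘ sym) q , refl , sym p))
  ... | no y≢u | no y≢v with p , q ← combine-injective i _ j _ eq =
    inj₁ (p , punchOut-injective y≢u y≢v q)

-- Two vertices are adjacent when some petal has an edge between them.  For
-- n ≥ 3 distinct petals share at most one vertex, so no loops or parallel
-- edges arise from the identifications.
flower : ∀ {k} → Graph (suc k) → {x y : Fin (suc k)} → x ≢ y →
         (n : ℕ) → 3 ℕ.≤ n → Graph (n ℕ.* k)
flower {k} G {x} {y} x≢y n 3≤n = record
  { Adj    = λ p q → ∃ λ i → ∃₂ λ u v → glue x≢y i u ≡ p × glue x≢y i v ≡ q × Adj u v
  ; adj?   = λ p q → any? λ i → any? λ u → any? λ v →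
               (glue x≢y i u Fin.≟ p) ×-dec (glue x≢y i v Fin.≟ q) ×-dec adj? u v
  ; symm   = λ (i , u , v , p , q , a) → i , v , u , q , p , symm a
  ; irrefl = λ { refl (i , u , v , p , q , a) → noLoop i (trans p (sym q)) a }
  }
  where
  open Graph G

  noLoop : ∀ i {u v} → glue x≢y i u ≡ glue x≢y i v → Adj u v → ⊥
  noLoop i eq a with glue-kernel x≢y eq
  ... | inj₁ (_ , u≡v)            = irrefl u≡v a
  ... | inj₂ (inj₁ (_ , _ , i+1≡i)) = next≢ (ℕ.≤-trans (ℕ.n≤1+n 2) 3≤n) i i+1≡i
  ... | inj₂ (inj₂ (_ , _ , i+1≡i)) = next≢ (ℕ.≤-trans (ℕ.n≤1+n 2) 3≤n) i i+1≡i

-- As both the terms and the limit are rational, it makes no difference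
-- that ε ranges over the positive rationals rather than the reals.
infix 4 _⟶_

_⟶_ : (ℕ → ℚ) → ℚ → Set
a ⟶ ℓ = ∀ ε → 0ℚ < ε → ∃ λ K → ∀ n → K ℕ.≤ n → ∣ a n - ℓ ∣ < ε

{-# OPTIONS --safe #-}

-- Summing up petals, a potential on the flower is a family of potentials on
-- the copies of G that agree at the shared vertices.  Ground y and let Θ u be
-- the potential on G of a unit current from u to y, so that r = r(x,y) is
-- Θ x x.  Put s(u) = Θ x u / r, h(u) = Θ u u - Θ x u, and give vertex u of
-- petal i the position i + 1 - s(u) on a circle of length n.  Explicit
-- potentials show that the resistance between vertices of distinct petals at
-- positions a and b is h(u) + h(v) + r (δ - δ²/n) with δ = b - a, while
-- resistances within a petal do not exceed those of G.  Since δ - δ²/n is at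
-- most n/4, and comes within 1/n of it for opposite petals, M n lies between
-- 2 max h + r n/4 - r/n and 2 max h + r n/4 for all large n.

module Submission where

open import Defs
open import Algebra.Bundles using (CommutativeRing)
open import Data.Bool.Base using (if_then_else_)
open import Data.Empty using (⊥-elim)
open import Data.Fin.Base as Fin using (Fin; zero; suc; toℕ)
import Data.Fin.Properties as Fin
open import Data.Nat.Base as ℕ using (ℕ; zero; suc)
open import Data.Nat.DivMod using (_mod_; m<n⇒m%n≡m; n%n≡0)
import Data.Nat.Properties as ℕ
open import Data.Integer.Base as ℤ using (-[1+_])
import Data.Integer.Properties as ℤ
open import Data.Product using (∃; _×_; _,_; proj₁; proj₂)
open import Data.Rational.Base
  using (ℚ; 0ℚ; 1ℚ; mkℚ; toℚᵘ; _*_; _-_; -_; _/_; 1/_; ∣_∣; _≤_; _<_;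
         ≢-nonZero; nonNegative; positive)
import Data.Rational.Properties as ℚ
open import Data.Rational.Unnormalised.Base as ℚᵘ using (mkℚᵘ)
import Data.Rational.Unnormalised.Properties as ℚᵘ
open import Data.Rational.Solver using (module +-*-Solver)
open import Data.Vec.Functional using (Vector)
open import Data.Sum.Base using (inj₁; inj₂)
open import Function.Base using (_∘_)
open import Relation.Binary.Construct.Closure.ReflexiveTransitive using (fold)
open import Relation.Binary.Definitions using (Tri; tri<; tri≈; tri>)
open import Relation.Binary.PropositionalEquality
open import Relation.Nullary using (Dec; yes; no; does; ¬_)
open import Relation.Nullary.Decidable using (_×-dec_; toWitness)
open import Algebra.Properties.Semiring.Sum
  (CommutativeRing.semiring ℚ.+-*-commutativeRing)
  using (sum; sum-syntax; sum-cong-≗; sum-replicate-zero; ∑-distrib-+; ∑-comm;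
         *-distribˡ-sum; *-distribʳ-sum)
open +-*-Solver
open ≡-Reasoning

-- Finite sums and the dot product.

module _ where
  open Data.Rational.Base using (_+_)

  ∑-zero : ∀ {n} {t : Vector ℚ n} → (∀ i → t i ≡ 0ℚ) → sum t ≡ 0ℚ
  ∑-zero {n} t≡0 = trans (sum-cong-≗ t≡0) (sum-replicate-zero n)

  ∑-single : ∀ {n} (t : Vector ℚ n) i → (∀ j → j ≢ i → t j ≡ 0ℚ) → sum t ≡ t i
  ∑-single t zero    t≡0 = trans
    (cong (t zero +_) (∑-zero λ j → t≡0 (suc j) λ ()))
    (ℚ.+-identityʳ (t zero))
  ∑-single t (suc i) t≡0 = trans
    (cong₂ _+_ (t≡0 zero λ ()) (∑-single (t ∘ suc) i λ j j≢i → t≡0 (suc j) (j≢i ∘ Fin.suc-injective)))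
    (ℚ.+-identityˡ (t (suc i)))

  ∑-nonneg : ∀ {n} {t : Vector ℚ n} → (∀ i → 0ℚ ≤ t i) → 0ℚ ≤ sum t
  ∑-nonneg {zero}  _   = ℚ.≤-refl
  ∑-nonneg {suc n} 0≤t = ℚ.+-mono-≤ (0≤t zero) (∑-nonneg (0≤t ∘ suc))

  ∑-nonneg≡0 : ∀ {n} {t : Vector ℚ n} → (∀ i → 0ℚ ≤ t i) → sum t ≡ 0ℚ → ∀ i → t i ≡ 0ℚ
  ∑-nonneg≡0 {suc n} {t} 0≤t ∑≡0 i
    with p , q ← sum-nonneg≡0 (t zero) (sum (t ∘ suc)) (0≤t zero) (∑-nonneg (0≤t ∘ suc)) ∑≡0
    with i
  ... | zero  = p
  ... | suc j = ∑-nonneg≡0 (0≤t ∘ suc) q j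

  ∑-telescope : ∀ n (V : ℕ → ℚ) → ∑[ j < n ] (V (toℕ j) - V (suc (toℕ j))) ≡ V 0 - V n
  ∑-telescope zero    V = sym (ℚ.+-inverseʳ (V 0))
  ∑-telescope (suc n) V = trans
    (cong (V 0 - V 1 +_) (∑-telescope n (V ∘ suc)))
    (solve 3 (λ a b c → (a :- b) :+ (b :- c) := a :- c) refl (V 0) (V 1) (V (suc n)))

  ∙-linear : ∀ {n} (x : Vector ℚ n) a y b z →
             x ∙ (λ i → a * y i + b * z i) ≡ a * (x ∙ y) + b * (x ∙ z)
  ∙-linear x a y b z = begin
    x ∙ (λ i → a * y i + b * z i)
      ≡⟨ ∙-congˡ x (λ i → cong₂ _+_ (ℚ.*-comm a (y i)) (ℚ.*-comm b (z i))) ⟩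
    x ∙ (λ i → y i * a + z i * b)
      ≡⟨ ∙-distrib-+ x (λ i → y i * a) (λ i → z i * b) ⟩
    x ∙ (λ i → y i * a) + x ∙ (λ i → z i * b)
      ≡⟨ cong₂ _+_ (∙-scale x y a) (∙-scale x z b) ⟩
    (x ∙ y) * a + (x ∙ z) * b
      ≡⟨ cong₂ _+_ (ℚ.*-comm (x ∙ y) a) (ℚ.*-comm (x ∙ z) b) ⟩
    a * (x ∙ y) + b * (x ∙ z) ∎

  ∙-distrib-- : ∀ {n} (x y z : Vector ℚ n) → x ∙ (λ i → y i - z i) ≡ x ∙ y - x ∙ z
  ∙-distrib-- x y z = begin
    x ∙ (λ i → y i - z i)
      ≡⟨ ∙-congˡ x (λ i → as-linear (y i) (z i)) ⟩
    x ∙ (λ i → 1ℚ * y i + - 1ℚ * z i)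
      ≡⟨ ∙-linear x 1ℚ y (- 1ℚ) z ⟩
    1ℚ * (x ∙ y) + - 1ℚ * (x ∙ z)
      ≡⟨ as-linear (x ∙ y) (x ∙ z) ⟨
    x ∙ y - x ∙ z ∎
    where
    as-linear : ∀ p q → p - q ≡ 1ℚ * p + - 1ℚ * q
    as-linear = solve 2 (λ p q → p :- q := con 1ℚ :* p :+ con (- 1ℚ) :* q) refl

  ·ᵥ-assoc : ∀ {m n p} (A : Matrix m n) (B : Matrix n p) x → A · B ·ᵥ x ≗ A ·ᵥ (B ·ᵥ x)
  ·ᵥ-assoc A B x i = ·-assoc A B (λ k (_ : Fin 1) → x k) i zero

  e-refl : ∀ {N} (u : Fin N) → e u u ≡ 1ℚ
  e-refl u with u Fin.≟ u
  ... | yes _   = refl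
  ... | no  u≢u = ⊥-elim (u≢u refl)

  e-≢ : ∀ {N} {u v : Fin N} → u ≢ v → e u v ≡ 0ℚ
  e-≢ {u = u} {v} u≢v with u Fin.≟ v
  ... | yes u≡v = ⊥-elim (u≢v u≡v)
  ... | no  _   = refl

  e-∙ : ∀ {N} (u : Fin N) f → e u ∙ f ≡ f u
  e-∙ u f = begin
    e u ∙ f       ≡⟨ ∑-single (λ i → e u i * f i) u (λ j j≢u →
                       trans (cong (_* f j) (e-≢ (j≢u ∘ sym))) (ℚ.*-zeroˡ (f j))) ⟩
    e u u * f u   ≡⟨ cong (_* f u) (e-refl u) ⟩
    1ℚ * f u      ≡⟨ ℚ.*-identityˡ (f u) ⟩
    f u           ∎

  ∙-e : ∀ {N} f (u : Fin N) → f ∙ e u ≡ f u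
  ∙-e f u = trans (∙-comm f (e u)) (e-∙ u f)

-- Laplacians and potentials

module _ {N} (G : Graph N) where
  open Data.Rational.Base using (_+_)
  open Graph G

  adjacency-adj : ∀ {u v} → Adj u v → adjacency G u v ≡ 1ℚ
  adjacency-adj {u} {v} a with adj? u v
  ... | yes _ = refl
  ... | no ¬a = ⊥-elim (¬a a)

  adjacency-sym : ∀ u v → adjacency G u v ≡ adjacency G v u
  adjacency-sym u v with adj? u v
  ... | yes a = sym (adjacency-adj (symm a))
  ... | no ¬a with adj? v u
  ...   | yes a = ⊥-elim (¬a (symm a))
  ...   | no  _ = refl

  adjacency-nonneg : ∀ u v → 0ℚ ≤ adjacency G u v
  adjacency-nonneg u v with adj? u v
  ... | yes _ = ℚ.nonNegative⁻¹ 1ℚ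
  ... | no  _ = ℚ.≤-refl

  laplacian-sym : ∀ u v → laplacian G u v ≡ laplacian G v u
  laplacian-sym u v = cong₂ _-_ (diagonal u v) (adjacency-sym u v)
    where
    diagonal : ∀ u v → degree G u * e u v ≡ degree G v * e v u
    diagonal u v with u Fin.≟ v
    ... | yes refl = cong (degree G u *_) (sym (e-refl u))
    ... | no  u≢v  = trans (ℚ.*-zeroʳ (degree G u))
                       (sym (trans (cong (degree G v *_) (e-≢ (u≢v ∘ sym))) (ℚ.*-zeroʳ (degree G v))))

  laplacian-adjoint : ∀ f g → f ∙ (laplacian G ·ᵥ g) ≡ (laplacian G ·ᵥ f) ∙ g
  laplacian-adjoint f g = trans (·ᵥ-adjoint (laplacian G) f g)
    (∙-cong (λ v → ∙-cong {y = f} (λ u → laplacian-sym u v) (λ _ → refl)) (λ _ → refl))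

  laplacian-·ᵥ : ∀ f u → (laplacian G ·ᵥ f) u ≡ ∑[ v < N ] (adjacency G u v * (f u - f v))
  laplacian-·ᵥ f u = begin
    (laplacian G ·ᵥ f) u
      ≡⟨ ∙-comm (laplacian G u) f ⟩
    f ∙ (λ v → degree G u * e u v - adjacency G u v)
      ≡⟨ ∙-distrib-- f (λ v → degree G u * e u v) (adjacency G u) ⟩
    f ∙ (λ v → degree G u * e u v) - f ∙ adjacency G u
      ≡⟨ cong (_- f ∙ adjacency G u) (trans
           (∙-congˡ f (λ v → ℚ.*-comm (degree G u) (e u v)))
           (trans (∙-scale f (e u) (degree G u)) (cong (_* degree G u) (∙-e f u)))) ⟩
    f u * degree G u - f ∙ adjacency G u
      ≡⟨ cong₂ _-_ (ℚ.*-comm (f u) (degree G u)) (∙-comm f (adjacency G u)) ⟩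
    degree G u * f u - adjacency G u ∙ f
      ≡⟨ cong (_- adjacency G u ∙ f) (*-distribʳ-sum (f u) (adjacency G u)) ⟩
    adjacency G u ∙ (λ _ → f u) - adjacency G u ∙ f
      ≡⟨ ∙-distrib-- (adjacency G u) (λ _ → f u) f ⟨
    ∑[ v < N ] (adjacency G u v * (f u - f v)) ∎

  laplacian-const : ∀ c u → (laplacian G ·ᵥ (λ _ → c)) u ≡ 0ℚ
  laplacian-const c u = trans (laplacian-·ᵥ (λ _ → c) u)
    (∑-zero λ v → trans (cong (adjacency G u v *_) (ℚ.+-inverseʳ c)) (ℚ.*-zeroʳ (adjacency G u v)))

  -- The square splits into two flow terms that differ by exchanging the endpoints, and each of them
  -- sums to the energy of `f`. Ordered pairs count every edge twice, hence the doubled energy on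
  -- the right.
  dirichlet : ∀ f → ∑[ u < N ] ∑[ v < N ] (adjacency G u v * ((f u - f v) * (f u - f v)))
                    ≡ f ∙ (laplacian G ·ᵥ f) + f ∙ (laplacian G ·ᵥ f)
  dirichlet f = begin
    ∑[ u < N ] ∑[ v < N ] (adjacency G u v * ((f u - f v) * (f u - f v)))
      ≡⟨ sum-cong-≗ (λ u → sum-cong-≗ λ v →
           solve 3 (λ a p q → a :* ((p :- q) :* (p :- q))
                              := p :* (a :* (p :- q)) :+ q :* (a :* (q :- p)))
             refl (adjacency G u v) (f u) (f v)) ⟩
    ∑[ u < N ] ∑[ v < N ] (flow u v + f v * (adjacency G u v * (f v - f u)))
      ≡⟨ sum-cong-≗ (λ u → trans
           (sum-cong-≗ λ v → cong (λ a → flow u v + f v * (a * (f v - f u))) (adjacency-sym u v))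
           (∑-distrib-+ (flow u) (λ v → flow v u))) ⟩
    ∑[ u < N ] (∑[ v < N ] flow u v + ∑[ v < N ] flow v u)
      ≡⟨ ∑-distrib-+ (λ u → ∑[ v < N ] flow u v) (λ u → ∑[ v < N ] flow v u) ⟩
    ∑[ u < N ] ∑[ v < N ] flow u v + ∑[ u < N ] ∑[ v < N ] flow v u
      ≡⟨ cong (∑[ u < N ] ∑[ v < N ] flow u v +_) (∑-comm (λ u v → flow v u)) ⟩
    ∑[ u < N ] ∑[ v < N ] flow u v + ∑[ u < N ] ∑[ v < N ] flow u v
      ≡⟨ cong₂ _+_ total total ⟩
    f ∙ (laplacian G ·ᵥ f) + f ∙ (laplacian G ·ᵥ f) ∎
    where
    flow : Matrix N N
    flow u v = f u * (adjacency G u v * (f u - f v))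

    total : ∑[ u < N ] ∑[ v < N ] flow u v ≡ f ∙ (laplacian G ·ᵥ f)
    total = sum-cong-≗ λ u → trans
      (sym (*-distribˡ-sum (f u) (λ v → adjacency G u v * (f u - f v))))
      (cong (f u *_) (sym (laplacian-·ᵥ f u)))

  private
    dirichlet-nonneg : ∀ (f : Vector ℚ N) u v → 0ℚ ≤ adjacency G u v * ((f u - f v) * (f u - f v))
    dirichlet-nonneg f u v = subst (_≤ adjacency G u v * ((f u - f v) * (f u - f v)))
      (ℚ.*-zeroʳ (adjacency G u v))
      (ℚ.*-monoˡ-≤-nonNeg (adjacency G u v) {{nonNegative (adjacency-nonneg u v)}}
        (square-nonneg (f u - f v)))

  -- By `dirichlet` twice the energy is a sum of nonnegative terms, whereas a negative energy would
  -- have a negative double.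
  laplacian-nonneg : ∀ f → 0ℚ ≤ f ∙ (laplacian G ·ᵥ f)
  laplacian-nonneg f = let E = f ∙ (laplacian G ·ᵥ f) in ℚ.≮⇒≥ λ neg → ℚ.<-irrefl refl
    (ℚ.≤-<-trans
      (ℚ.≤-trans (∑-nonneg λ u → ∑-nonneg (dirichlet-nonneg f u)) (ℚ.≤-reflexive (dirichlet f)))
      (ℚ.+-mono-< {E} {0ℚ} {E} {0ℚ} neg neg))

  -- Zero energy forces every term of the Dirichlet sum to vanish, so `f` agrees at the ends of each
  -- edge and, along paths, everywhere.
  laplacian-kernel : Connected G → ∀ f → f ∙ (laplacian G ·ᵥ f) ≡ 0ℚ → ∀ u v → f u ≡ f v
  laplacian-kernel connected f E≡0 u v =
    fold (λ u v → f u ≡ f v) (λ a → trans (step a)) refl (connected u v)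
    where
    step : ∀ {u v} → Adj u v → f u ≡ f v
    step {u} {v} a = begin
      f u               ≡⟨ solve 2 (λ p q → p := (p :- q) :+ q) refl (f u) (f v) ⟩
      (f u - f v) + f v ≡⟨ cong (_+ f v) (square≡0 (f u - f v) square) ⟩
      0ℚ + f v          ≡⟨ ℚ.+-identityˡ (f v) ⟩
      f v               ∎
      where
      square : (f u - f v) * (f u - f v) ≡ 0ℚ
      square = begin
        (f u - f v) * (f u - f v)
          ≡⟨ ℚ.*-identityˡ _ ⟨
        1ℚ * ((f u - f v) * (f u - f v))
          ≡⟨ cong (_* ((f u - f v) * (f u - f v))) (adjacency-adj a) ⟨
        adjacency G u v * ((f u - f v) * (f u - f v))
          ≡⟨ ∑-nonneg≡0 (dirichlet-nonneg f u)
               (∑-nonneg≡0 (λ u → ∑-nonneg (dirichlet-nonneg f u))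
                 (trans (dirichlet f) (cong₂ _+_ E≡0 E≡0)) u) v ⟩
        0ℚ ∎

  private
    X : Matrix N N
    X = laplacian G ⁺

    open module X = IsMoorePenrose (proj₂ (pseudoinverse (laplacian G)))

  -- Writing d = L f turns d ∙ L⁺ d into f ∙ L L⁺ L f, which the first Penrose condition reduces to
  -- f ∙ d. Any solution of L f = d will do, so resistances can be read off from explicit
  -- potentials.
  resistance-potential : ∀ {u v} f → laplacian G ·ᵥ f ≗ (λ i → e u i - e v i) →
                         resistance G u v ≡ f u - f v
  resistance-potential {u} {v} f Lf≡d = begin
    d ∙ (X ·ᵥ d)                        ≡⟨ ∙-cong Lf≡d (λ i → ∙-congˡ (X i) Lf≡d) ⟨
    (L ·ᵥ f) ∙ (X ·ᵥ (L ·ᵥ f))          ≡⟨ laplacian-adjoint f (X ·ᵥ (L ·ᵥ f)) ⟨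
    f ∙ (L ·ᵥ (X ·ᵥ (L ·ᵥ f)))          ≡⟨ ∙-congˡ f (·ᵥ-assoc L X (L ·ᵥ f)) ⟨
    f ∙ (L · X ·ᵥ (L ·ᵥ f))             ≡⟨ ∙-congˡ f (·ᵥ-assoc (L · X) L f) ⟨
    f ∙ (L · X · L ·ᵥ f)                ≡⟨ ∙-congˡ f (λ i → trans (∙-cong (AXA≐A i) (λ _ → refl)) (Lf≡d i)) ⟩
    f ∙ d                               ≡⟨ ∙-distrib-- f (e u) (e v) ⟩
    f ∙ e u - f ∙ e v                   ≡⟨ cong₂ _-_ (∙-e f u) (∙-e f v) ⟩
    f u - f v                           ∎
    where
    L = laplacian G
    d : Vector ℚ N
    d i = e u i - e v i

  -- L⁺ d is a potential: its residue h = d - L L⁺ d lies in the kernel of L,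
  -- hence is constant, hence orthogonal to d as well as to the range of L.
  potential : Connected G → ∀ u v → ∃ λ f → laplacian G ·ᵥ f ≗ λ i → e u i - e v i
  potential connected u v = X ·ᵥ d , λ i → begin
    (L ·ᵥ (X ·ᵥ d)) i           ≡⟨ solve 2 (λ p q → p := q :- (q :- p)) refl ((L ·ᵥ (X ·ᵥ d)) i) (d i) ⟩
    d i - h i                   ≡⟨ cong (λ t → d i - t) (norm≡0 h h∙h i) ⟩
    d i - 0ℚ                    ≡⟨ solve 1 (λ p → p :- con 0ℚ := p) refl (d i) ⟩
    d i                         ∎
    where
    L = laplacian G
    d h : Vector ℚ N
    d i = e u i - e v i
    h i = d i - (L ·ᵥ (X ·ᵥ d)) i

    -- Since L and L X are symmetric, this is the transpose of L X L = L.
    LLX : L · (L · X) ≐ L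
    LLX i k = begin
      L i ∙ (λ j → (L · X) j k)    ≡⟨ ∙-cong (λ j → laplacian-sym i j) (λ j → AX-sym k j) ⟩
      (L ᵀ) i ∙ (L · X) k          ≡⟨ ∙-comm ((L ᵀ) i) ((L · X) k) ⟩
      (L · X · L) k i              ≡⟨ AXA≐A k i ⟩
      L k i                        ≡⟨ laplacian-sym k i ⟩
      L i k                        ∎

    Lh : ∀ i → (L ·ᵥ h) i ≡ 0ℚ
    Lh i = begin
      (L ·ᵥ h) i                                    ≡⟨ ∙-distrib-- (L i) d (L ·ᵥ (X ·ᵥ d)) ⟩
      (L ·ᵥ d) i - (L ·ᵥ (L ·ᵥ (X ·ᵥ d))) i         ≡⟨ cong (λ t → (L ·ᵥ d) i - t) (begin
        (L ·ᵥ (L ·ᵥ (X ·ᵥ d))) i  ≡⟨ ∙-congˡ (L i) (·ᵥ-assoc L X d) ⟨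
        (L ·ᵥ (L · X ·ᵥ d)) i     ≡⟨ ·ᵥ-assoc L (L · X) d i ⟨
        (L · (L · X) ·ᵥ d) i      ≡⟨ ∙-cong (LLX i) (λ _ → refl) ⟩
        (L ·ᵥ d) i                ∎) ⟩
      (L ·ᵥ d) i - (L ·ᵥ d) i                       ≡⟨ ℚ.+-inverseʳ ((L ·ᵥ d) i) ⟩
      0ℚ                                            ∎

    h-const : h u ≡ h v
    h-const = laplacian-kernel connected h (trans (∙-comm h (L ·ᵥ h)) (0∙ (L ·ᵥ h) h Lh)) u v

    h∙h : h ∙ h ≡ 0ℚ
    h∙h = begin
      h ∙ h
        ≡⟨ ∙-distrib-- h d (L ·ᵥ (X ·ᵥ d)) ⟩
      h ∙ d - h ∙ (L ·ᵥ (X ·ᵥ d))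
        ≡⟨ cong₂ _-_ (∙-distrib-- h (e u) (e v)) (laplacian-adjoint h (X ·ᵥ d)) ⟩
      (h ∙ e u - h ∙ e v) - (L ·ᵥ h) ∙ (X ·ᵥ d)
        ≡⟨ cong₂ _-_ (cong₂ _-_ (trans (∙-e h u) h-const) (∙-e h v))
             (0∙ (L ·ᵥ h) (X ·ᵥ d) Lh) ⟩
      (h v - h v) - 0ℚ
        ≡⟨ solve 1 (λ p → (p :- p) :- con 0ℚ := con 0ℚ) refl (h v) ⟩
      0ℚ ∎

-- Indicators of decidable propositions.

module _ where
  open Data.Rational.Base using (_+_)

  -- Both `e u v` and `adjacency G u v` unfold to this form, so rules for indicators apply to them
  -- directly.
  𝟙 : ∀ {ℓ} {P : Set ℓ} → Dec P → ℚ
  𝟙 P? = if does P? then 1ℚ else 0ℚ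

  𝟙-yes : ∀ {ℓ} {P : Set ℓ} (P? : Dec P) → P → 𝟙 P? ≡ 1ℚ
  𝟙-yes (yes _) _ = refl
  𝟙-yes (no ¬p) p = ⊥-elim (¬p p)

  𝟙-no : ∀ {ℓ} {P : Set ℓ} (P? : Dec P) → ¬ P → 𝟙 P? ≡ 0ℚ
  𝟙-no (yes p) ¬p = ⊥-elim (¬p p)
  𝟙-no (no _)  _  = refl

  𝟙-× : ∀ {ℓ ℓ′} {P : Set ℓ} {Q : Set ℓ′} (P? : Dec P) (Q? : Dec Q) →
        𝟙 (P? ×-dec Q?) ≡ 𝟙 P? * 𝟙 Q?
  𝟙-× (yes _) Q? = sym (ℚ.*-identityˡ (𝟙 Q?))
  𝟙-× (no  _) Q? = sym (ℚ.*-zeroˡ (𝟙 Q?))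

  -- Uniqueness of the witness ensures that the sum counts it only once.
  𝟙-any : ∀ {n ℓ} {P : Fin n → Set ℓ} (P? : ∀ i → Dec (P i)) →
          (∀ {i j} → P i → P j → i ≡ j) → 𝟙 (Fin.any? P?) ≡ ∑[ i < n ] 𝟙 (P? i)
  𝟙-any P? unique = helper (Fin.any? P?)
    where
    helper : (any? : Dec (∃ _)) → 𝟙 any? ≡ sum (λ i → 𝟙 (P? i))
    helper (yes (i , p)) = sym (trans
      (∑-single (λ i → 𝟙 (P? i)) i λ j j≢i → 𝟙-no (P? j) λ q → j≢i (unique q p))
      (𝟙-yes (P? i) p))
    helper (no ¬p) = sym (∑-zero λ i → 𝟙-no (P? i) λ p → ¬p (i , p))

  e-*-cong : ∀ {N} (p q : Fin N) (h : Fin N → ℚ) → e p q * h q ≡ e p q * h p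
  e-*-cong p q h with p Fin.≟ q
  ... | yes refl = refl
  ... | no  _    = trans (ℚ.*-zeroˡ (h q)) (sym (ℚ.*-zeroˡ (h p)))

-- The Laplacian of a flower

-- This is where three petals are required: two petals closed up into a ring would share both of
-- their junctions.
next²≢ : ∀ {n} → 3 ℕ.≤ n → (i : Fin n) → next (next i) ≢ i
next²≢ {n} 3≤n i eq with toℕ-next i | toℕ-next (next i)
... | inj₁ p | inj₁ q = ℕ.<⇒≢ (ℕ.m<n⇒m<1+n (ℕ.n<1+n (toℕ i)))
      (trans (sym (cong toℕ eq)) (trans q (cong suc p)))
... | inj₁ p | inj₂ (q , r) = ℕ.<⇒≢ 3≤n
      (trans (cong (λ t → suc (suc t)) (trans (sym q) (cong toℕ eq))) (trans (cong suc (sym p)) r))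
... | inj₂ (p , r) | inj₁ q = ℕ.<⇒≢ 3≤n
      (trans (cong suc (trans (cong suc (sym p)) (trans (sym q) (cong toℕ eq)))) r)
... | inj₂ (p , r) | inj₂ (q , s) = ℕ.<⇒≢ (ℕ.≤-trans (ℕ.n≤1+n 2) 3≤n)
      (trans (cong suc (sym p)) s)

module _ {k} (G : Graph (suc k)) {x y : Fin (suc k)} (x≢y : x ≢ y)
         (n : ℕ) (3≤n : 3 ℕ.≤ n) where
  open Data.Rational.Base using (_+_)
  open Graph G

  private
    F = flower G x≢y n 3≤n
    g : Fin n → Fin (suc k) → Fin (n ℕ.* k)
    g = glue x≢y

  glue-injective : ∀ i {u v} → g i u ≡ g i v → u ≡ v
  glue-injective i eq with glue-kernel x≢y eq
  ... | inj₁ (_ , u≡v) = u≡v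
  ... | inj₂ (inj₁ (_ , _ , loop)) = ⊥-elim (next≢ (ℕ.≤-trans (ℕ.n≤1+n 2) 3≤n) i loop)
  ... | inj₂ (inj₂ (_ , _ , loop)) = ⊥-elim (next≢ (ℕ.≤-trans (ℕ.n≤1+n 2) 3≤n) i loop)

  -- If two different petals shared both ends of an edge, either the ends would coincide, making the
  -- edge a loop, or they would be `x` and `y` and each petal would be the successor of the other.
  edge-petal : ∀ {i j u v u′ v′} → g i u ≡ g j u′ → g i v ≡ g j v′ → Adj u v → i ≡ j
  edge-petal {i} eq eq′ a with glue-kernel x≢y eq | glue-kernel x≢y eq′
  ... | inj₁ (i≡j , _) | _ = i≡j
  ... | _ | inj₁ (i≡j , _) = i≡j
  ... | inj₂ (inj₁ (u≡y , _)) | inj₂ (inj₁ (v≡y , _)) = ⊥-elim (irrefl (trans u≡y (sym v≡y)) a)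
  ... | inj₂ (inj₂ (u≡x , _)) | inj₂ (inj₂ (v≡x , _)) = ⊥-elim (irrefl (trans u≡x (sym v≡x)) a)
  ... | inj₂ (inj₁ (_ , _ , p)) | inj₂ (inj₂ (_ , _ , q)) =
        ⊥-elim (next²≢ 3≤n i (trans (cong next p) q))
  ... | inj₂ (inj₂ (_ , _ , p)) | inj₂ (inj₁ (_ , _ , q)) =
        ⊥-elim (next²≢ 3≤n i (trans (cong next q) p))

  -- Each of the three nested existentials in the adjacency of the flower has at most one witness:
  -- the petal by `edge-petal`, the two endpoints by `glue-injective`. So `𝟙-any` turns them into
  -- sums.
  flower-adjacency : ∀ p q → adjacency F p q ≡
    ∑[ i < n ] ∑[ u < suc k ] ∑[ v < suc k ] (e (g i u) p * (e (g i v) q * adjacency G u v))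
  flower-adjacency p q =
    trans (𝟙-any (λ i → Fin.any? λ u → Fin.any? λ v → edge? i u v)
            λ (_ , _ , r , s , a) (_ , _ , r′ , s′ , _) →
              edge-petal (trans r (sym r′)) (trans s (sym s′)) a)
    (sum-cong-≗ λ i → trans
      (𝟙-any (λ u → Fin.any? λ v → edge? i u v)
        λ (_ , r , _) (_ , r′ , _) → glue-injective i (trans r (sym r′)))
    (sum-cong-≗ λ u → trans
      (𝟙-any (λ v → edge? i u v)
        λ (_ , s , _) (_ , s′ , _) → glue-injective i (trans s (sym s′)))
    (sum-cong-≗ λ v → trans
      (𝟙-× (g i u Fin.≟ p) ((g i v Fin.≟ q) ×-dec adj? u v))
      (cong (e (g i u) p *_) (𝟙-× (g i v Fin.≟ q) (adj? u v))))))
    where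
    edge? : ∀ i u v → Dec (g i u ≡ p × g i v ≡ q × Adj u v)
    edge? i u v = (g i u Fin.≟ p) ×-dec (g i v Fin.≟ q) ×-dec adj? u v

  -- The edge set of the flower is the disjoint union of those of its petals. Hence its Laplacian
  -- acts by restricting `f` to each petal, applying the Laplacian of `G` there, and adding up the
  -- results at identified vertices.
  flower-laplacian : ∀ f p → (laplacian F ·ᵥ f) p ≡
    ∑[ i < n ] ((λ u → e (g i u) p) ∙ (laplacian G ·ᵥ (f ∘ g i)))
  flower-laplacian f p = begin
    (laplacian F ·ᵥ f) p
      ≡⟨ laplacian-·ᵥ F f p ⟩
    ∑[ q < n ℕ.* k ] (adjacency F p q * (f p - f q))
      ≡⟨ sum-cong-≗ (λ q → trans (cong (_* (f p - f q)) (flower-adjacency p q))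
           (trans (*-distribʳ-sum (f p - f q) (λ i → ∑[ u < suc k ] ∑[ v < suc k ] T q i u v))
           (sum-cong-≗ λ i → trans (*-distribʳ-sum (f p - f q) (λ u → ∑[ v < suc k ] T q i u v))
           (sum-cong-≗ λ u → *-distribʳ-sum (f p - f q) (T q i u))))) ⟩
    ∑[ q < n ℕ.* k ] ∑[ i < n ] ∑[ u < suc k ] ∑[ v < suc k ] (T q i u v * (f p - f q))
      ≡⟨ ∑-comm (λ q i → ∑[ u < suc k ] ∑[ v < suc k ] (T q i u v * (f p - f q))) ⟩
    ∑[ i < n ] ∑[ q < n ℕ.* k ] ∑[ u < suc k ] ∑[ v < suc k ] (T q i u v * (f p - f q))
      ≡⟨ sum-cong-≗ (λ i → trans
           (∑-comm (λ q u → ∑[ v < suc k ] (T q i u v * (f p - f q))))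
           (sum-cong-≗ λ u → trans (∑-comm (λ q v → T q i u v * (f p - f q)))
                              (petal i u))) ⟩
    ∑[ i < n ] ((λ u → e (g i u) p) ∙ (laplacian G ·ᵥ (f ∘ g i))) ∎
    where
    T : Fin (n ℕ.* k) → Fin n → Fin (suc k) → Fin (suc k) → ℚ
    T q i u v = e (g i u) p * (e (g i v) q * adjacency G u v)

    petal : ∀ i u → ∑[ v < suc k ] ∑[ q < n ℕ.* k ] (T q i u v * (f p - f q))
                    ≡ e (g i u) p * (laplacian G ·ᵥ (f ∘ g i)) u
    petal i u = begin
      ∑[ v < suc k ] ∑[ q < n ℕ.* k ] (T q i u v * (f p - f q))
        ≡⟨ sum-cong-≗ (λ v → begin
             ∑[ q < n ℕ.* k ] (T q i u v * (f p - f q))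
               ≡⟨ sum-cong-≗ (λ q → solve 4 (λ a b c d → (a :* (b :* c)) :* d := b :* (a :* (c :* d)))
                    refl (e (g i u) p) (e (g i v) q) (adjacency G u v) (f p - f q)) ⟩
             e (g i v) ∙ (λ q → e (g i u) p * (adjacency G u v * (f p - f q)))
               ≡⟨ e-∙ (g i v) (λ q → e (g i u) p * (adjacency G u v * (f p - f q))) ⟩
             e (g i u) p * (adjacency G u v * (f p - f (g i v)))
               -- The factor `e (g i u) p` vanishes unless `p` is `g i u`, so `f p` may be replaced
               -- by `f (g i u)`.
               ≡⟨ e-*-cong (g i u) p (λ p → adjacency G u v * (f p - f (g i v))) ⟩
             e (g i u) p * (adjacency G u v * (f (g i u) - f (g i v))) ∎) ⟩
      ∑[ v < suc k ] (e (g i u) p * (adjacency G u v * (f (g i u) - f (g i v))))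
        ≡⟨ *-distribˡ-sum (e (g i u) p) (λ v → adjacency G u v * (f (g i u) - f (g i v))) ⟨
      e (g i u) p * ∑[ v < suc k ] (adjacency G u v * (f (g i u) - f (g i v)))
        ≡⟨ cong (e (g i u) p *_) (laplacian-·ᵥ G (f ∘ g i) u) ⟨
      e (g i u) p * (laplacian G ·ᵥ (f ∘ g i)) u ∎

-- Grounded potentials

-- `Θ` is the Green's function of `G` grounded at `y`: the inverse of the Laplacian with row and
-- column `y` deleted, bordered by zeros.
record Grounded {N} (G : Graph N) (y : Fin N) : Set where
  field
    Θ   : Matrix N N
    LΘ  : ∀ u → laplacian G ·ᵥ Θ u ≗ λ i → e u i - e y i
    Θ-y : ∀ u → Θ u y ≡ 0ℚ

ground : ∀ {N} (G : Graph N) → Connected G → ∀ y → Grounded G y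
ground {N} G connected y = record
  { Θ = λ u v → f u v - f u y ; LΘ = grounded-laplacian ; Θ-y = λ u → ℚ.+-inverseʳ (f u y) }
  where
  f : Matrix N N
  f u = proj₁ (potential G connected u y)

  grounded-laplacian : ∀ u → laplacian G ·ᵥ (λ v → f u v - f u y) ≗ λ i → e u i - e y i
  grounded-laplacian u i = begin
    (laplacian G ·ᵥ (λ v → f u v - f u y)) i
      ≡⟨ ∙-distrib-- (laplacian G i) (f u) (λ _ → f u y) ⟩
    (laplacian G ·ᵥ f u) i - (laplacian G ·ᵥ (λ _ → f u y)) i
      ≡⟨ cong₂ _-_ (proj₂ (potential G connected u y) i) (laplacian-const G (f u y) i) ⟩
    (e u i - e y i) - 0ℚ
      ≡⟨ solve 1 (λ p → p :- con 0ℚ := p) refl (e u i - e y i) ⟩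
    e u i - e y i ∎

module _ {N} (G : Graph N) {y : Fin N} (grounded : Grounded G y) where
  open Grounded grounded

  private
    grounded-∙ : ∀ u v → Θ u ∙ (λ i → e v i - e y i) ≡ Θ u v
    grounded-∙ u v = begin
      Θ u ∙ (λ i → e v i - e y i)   ≡⟨ ∙-distrib-- (Θ u) (e v) (e y) ⟩
      Θ u ∙ e v - Θ u ∙ e y         ≡⟨ cong₂ _-_ (∙-e (Θ u) v) (trans (∙-e (Θ u) y) (Θ-y u)) ⟩
      Θ u v - 0ℚ                    ≡⟨ solve 1 (λ p → p :- con 0ℚ := p) refl (Θ u v) ⟩
      Θ u v                         ∎

    grounded-energy : ∀ u v → Θ u ∙ (laplacian G ·ᵥ Θ v) ≡ Θ u v
    grounded-energy u v = trans (∙-congˡ (Θ u) (LΘ v)) (grounded-∙ u v)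

  -- Reciprocity: both sides are the mutual energy of `Θ u` and `Θ v`, and the Laplacian is
  -- self-adjoint.
  Θ-sym : ∀ u v → Θ u v ≡ Θ v u
  Θ-sym u v = begin
    Θ u v                           ≡⟨ grounded-energy u v ⟨
    Θ u ∙ (laplacian G ·ᵥ Θ v)      ≡⟨ laplacian-adjoint G (Θ u) (Θ v) ⟩
    (laplacian G ·ᵥ Θ u) ∙ Θ v      ≡⟨ ∙-comm (laplacian G ·ᵥ Θ u) (Θ v) ⟩
    Θ v ∙ (laplacian G ·ᵥ Θ u)      ≡⟨ grounded-energy v u ⟩
    Θ v u                           ∎

  resistance-grounded : ∀ u v → resistance G u v ≡
    (Θ u u - Θ v u) - (Θ u v - Θ v v)
  resistance-grounded u v = resistance-potential G (λ i → Θ u i - Θ v i) λ i → begin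
    (laplacian G ·ᵥ (λ i → Θ u i - Θ v i)) i
      ≡⟨ ∙-distrib-- (laplacian G i) (Θ u) (Θ v) ⟩
    (laplacian G ·ᵥ Θ u) i - (laplacian G ·ᵥ Θ v) i
      ≡⟨ cong₂ _-_ (LΘ u i) (LΘ v i) ⟩
    (e u i - e y i) - (e v i - e y i)
      ≡⟨ solve 3 (λ p q r → (p :- q) :- (r :- q) := p :- r) refl (e u i) (e y i) (e v i) ⟩
    e u i - e v i ∎

  resistance-ground : ∀ u → resistance G u y ≡ Θ u u
  resistance-ground u = begin
    resistance G u y   ≡⟨ resistance-potential G (Θ u) (LΘ u) ⟩
    Θ u u - Θ u y      ≡⟨ cong (λ t → Θ u u - t) (Θ-y u) ⟩
    Θ u u - 0ℚ         ≡⟨ solve 1 (λ p → p :- con 0ℚ := p) refl (Θ u u) ⟩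
    Θ u u              ∎

  -- `Θ u u` is the energy of `Θ u`. Were it not positive, `Θ u` would be constant, hence zero, and
  -- could not carry a unit current out of `u`.
  Θ-pos : Connected G → ∀ {u} → u ≢ y → 0ℚ < Θ u u
  Θ-pos connected {u} u≢y = ℚ.≰⇒> λ r≤0 → ℚ.1≢0 (begin
    1ℚ                                ≡⟨⟩
    1ℚ - 0ℚ                           ≡⟨ cong₂ _-_ (e-refl u) (e-≢ (u≢y ∘ sym)) ⟨
    e u u - e y u                     ≡⟨ LΘ u u ⟨
    (laplacian G ·ᵥ Θ u) u            ≡⟨ ∙-congˡ (laplacian G u) (Θ≡0 r≤0) ⟩
    (laplacian G ·ᵥ (λ _ → 0ℚ)) u     ≡⟨ laplacian-const G 0ℚ u ⟩
    0ℚ                                ∎)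
    where
    Θ≡0 : Θ u u ≤ 0ℚ → ∀ v → Θ u v ≡ 0ℚ
    Θ≡0 r≤0 v = trans
      (laplacian-kernel G connected (Θ u)
        (trans (grounded-energy u u)
          (ℚ.≤-antisym r≤0 (subst (0ℚ ≤_) (grounded-energy u u) (laplacian-nonneg G (Θ u)))))
        v y)
      (Θ-y u)

-- Equal to (r(u,x) + r(u,y) - r(x,y)) / 2: the leg at `u` of the star network equivalent to `G` at
-- the terminals `x`, `y`, `u`.
height : ∀ {N} {G : Graph N} {y} → Grounded G y → Fin N → Fin N → ℚ
height grounded x u = Θ u u - Θ x u
  where open Grounded grounded

-- Potentials on a cycle of unit resistors.

module _ where
  open Data.Rational.Base using (_+_)

  -- Recursion makes `ι (suc n)` unfold to `1ℚ + ι n`, the form in which the ring solver meets it.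
  ι : ℕ → ℚ
  ι zero    = 0ℚ
  ι (suc n) = 1ℚ + ι n

-- W is the potential on a cycle of N unit resistors, cut open at node 0, for
-- a unit current that enters in the ratio s : 1 - s at the nodes i and i + 1
-- and leaves at node 0; A is the fraction of the cycle before the centre of
-- mass i + 1 - s of the injected current.
module Profile (N A s : ℚ) (i : ℕ)
  (A*N≡ : A * N ≡ ι (suc i) - s) where
  open Data.Rational.Base using (_+_)

  -- `σ b` is the forward current in the resistor after node b, except that at b = i the injected s
  -- is left out. Thus all of the unit jump of `σ` lies between i and i + 1.
  W σ : ℕ → ℚ
  W b with b ℕ.≤? i
  ... | yes _ = ι b * (1ℚ - A)
  ... | no  _ = A * (N - ι b)
  σ b with b ℕ.≤? i
  ... | yes _ = A - 1ℚ
  ... | no  _ = A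

  W-≤ : ∀ {b} → b ℕ.≤ i → W b ≡ ι b * (1ℚ - A)
  W-≤ {b} b≤i with b ℕ.≤? i
  ... | yes _   = refl
  ... | no  b≰i = ⊥-elim (b≰i b≤i)

  W-> : ∀ {b} → i ℕ.< b → W b ≡ A * (N - ι b)
  W-> {b} i<b with b ℕ.≤? i
  ... | yes b≤i = ⊥-elim (ℕ.<⇒≱ i<b b≤i)
  ... | no  _   = refl

  σ-≤ : ∀ {b} → b ℕ.≤ i → σ b ≡ A - 1ℚ
  σ-≤ {b} b≤i with b ℕ.≤? i
  ... | yes _   = refl
  ... | no  b≰i = ⊥-elim (b≰i b≤i)

  σ-> : ∀ {b} → i ℕ.< b → σ b ≡ A
  σ-> {b} i<b with b ℕ.≤? i
  ... | yes b≤i = ⊥-elim (ℕ.<⇒≱ i<b b≤i)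
  ... | no  _   = refl

  slope-< : ∀ {j} → j ℕ.< i → W j - W (suc j) ≡ A - 1ℚ
  slope-< {j} j<i = trans (cong₂ _-_ (W-≤ (ℕ.<⇒≤ j<i)) (W-≤ j<i))
    (solve 2 (λ a j → j :* (con 1ℚ :- a) :- (con 1ℚ :+ j) :* (con 1ℚ :- a) := a :- con 1ℚ) refl A (ι j))

  slope-> : ∀ {j} → i ℕ.< j → W j - W (suc j) ≡ A
  slope-> {j} i<j = trans (cong₂ _-_ (W-> i<j) (W-> (ℕ.m<n⇒m<1+n i<j)))
    (solve 3 (λ a n j → a :* (n :- j) :- a :* (n :- (con 1ℚ :+ j)) := a) refl A N (ι j))

  -- The two branches of `W` are fixed by vanishing at nodes 0 and N. That they fit together across
  -- resistor i is the loop law, namely `A*N≡`.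
  slope-≡ : W i - W (suc i) ≡ A - 1ℚ + s
  slope-≡ = begin
    W i - W (suc i)
      ≡⟨ cong₂ _-_ (W-≤ ℕ.≤-refl) (W-> ℕ.≤-refl) ⟩
    ι i * (1ℚ - A) - A * (N - (1ℚ + ι i))
      ≡⟨ solve 3 (λ a n j → j :* (con 1ℚ :- a) :- a :* (n :- (con 1ℚ :+ j)) := j :+ a :- a :* n) refl A N (ι i) ⟩
    ι i + A - A * N
      ≡⟨ cong (λ t → ι i + A - t) A*N≡ ⟩
    ι i + A - (ι (suc i) - s)
      ≡⟨ solve 3 (λ j a s → j :+ a :- (con 1ℚ :+ j :- s) := a :- con 1ℚ :+ s) refl (ι i) A s ⟩
    A - 1ℚ + s ∎

-- Resistances in a flower

-- A vertex of the flower takes its value from an arbitrary representative. By `glue-kernel` two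
-- representatives differ at most by one junction, where the values agree by hypothesis.
glue-lift : ∀ {k n} {x y : Fin (suc k)} (x≢y : x ≢ y) (h : Fin n → Fin (suc k) → ℚ) →
            (∀ i → h i y ≡ h (next i) x) → ∃ λ f → ∀ i v → f (glue x≢y i v) ≡ h i v
glue-lift {x = x} {y} x≢y h h-y =
  (λ p → let (j , u , _) = glue-surjective x≢y p in h j u) ,
  (λ i v → let (_ , _ , eq) = glue-surjective x≢y (glue x≢y i v) in well-defined eq)
  where
  well-defined : ∀ {i j u v} → glue x≢y i u ≡ glue x≢y j v → h i u ≡ h j v
  well-defined {i} {j} eq with glue-kernel x≢y eq
  ... | inj₁ (refl , refl)               = refl
  ... | inj₂ (inj₁ (refl , refl , refl)) = h-y i
  ... | inj₂ (inj₂ (refl , refl , refl)) = sym (h-y j)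

-- `ν` is 1/n, given through its defining equation so that the ring solver can treat it as an atom.
module FlowerResistance {k} (G : Graph (suc k)) {x y : Fin (suc k)} (x≢y : x ≢ y)
  (grounded : Grounded G y) (r≢0 : Grounded.Θ grounded x x ≢ 0ℚ)
  (n₁ : ℕ) (3≤n : 3 ℕ.≤ suc n₁)
  (ν : ℚ) (ν-inverse : ν * ι (suc n₁) ≡ 1ℚ)
  where
  open Data.Rational.Base using (_+_)

  private
    n = suc n₁
    F = flower G x≢y n 3≤n
    g : Fin n → Fin (suc k) → Fin (n ℕ.* k)
    g = glue x≢y
    open Grounded grounded
    r = Θ x x

    instance
      r-nonZero = ≢-nonZero r≢0

  -- The potential at `u` when `x` is held at 1 and `y` at 0. By reciprocity it is also the fraction
  -- of a current entering at `u` that leaves through `x` when both are grounded.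
  share : Fin (suc k) → ℚ
  share u = Θ x u * 1/ r

  share-* : ∀ u → share u * r ≡ Θ x u
  share-* u = trans (ℚ.*-assoc (Θ x u) (1/ r) r)
    (trans (cong (Θ x u *_) (ℚ.*-inverseˡ r)) (ℚ.*-identityʳ (Θ x u)))

  position : Fin n → Fin (suc k) → ℚ
  position i u = ι (suc (toℕ i)) - share u

  private
    N = ι n

    module P (i : Fin n) (u : Fin (suc k)) where
      a = position i u
      A = a * ν

      A*N : A * N ≡ a
      A*N = trans (ℚ.*-assoc a ν N) (trans (cong (a *_) ν-inverse) (ℚ.*-identityʳ a))

      open Profile N A (share u) (toℕ i) A*N public

      -- The coefficient of `Θ x` in petal j, that is, the current sent from its `x` to its `y`. The
      -- drop from `x` to `y` must be r times that of `W`; in petal i, `Θ u` already supplies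
      -- `share u * r` of it.
      c : Fin n → ℚ
      c j = W (toℕ j) - W (suc (toℕ j)) - e i j * share u

      c-σ : ∀ j → c j ≡ σ (toℕ j)
      c-σ j with ℕ.<-cmp (toℕ j) (toℕ i)
      ... | tri< j<i j≢i _ = begin
              W (toℕ j) - W (suc (toℕ j)) - e i j * share u
                ≡⟨ cong₂ (λ t d → t - d * share u) (slope-< j<i) (e-≢ (j≢i ∘ cong toℕ ∘ sym)) ⟩
              A - 1ℚ - 0ℚ * share u
                ≡⟨ solve 2 (λ a s → a :- con 0ℚ :* s := a) refl (A - 1ℚ) (share u) ⟩
              A - 1ℚ
                ≡⟨ σ-≤ (ℕ.<⇒≤ j<i) ⟨
              σ (toℕ j) ∎
      ... | tri> _ j≢i i<j = begin
              W (toℕ j) - W (suc (toℕ j)) - e i j * share u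
                ≡⟨ cong₂ (λ t d → t - d * share u) (slope-> i<j) (e-≢ (j≢i ∘ cong toℕ ∘ sym)) ⟩
              A - 0ℚ * share u
                ≡⟨ solve 2 (λ a s → a :- con 0ℚ :* s := a) refl A (share u) ⟩
              A
                ≡⟨ σ-> i<j ⟨
              σ (toℕ j) ∎
      ... | tri≈ _ j≡i _ with refl ← Fin.toℕ-injective j≡i = begin
              W (toℕ i) - W (suc (toℕ i)) - e i i * share u
                ≡⟨ cong₂ (λ t d → t - d * share u) slope-≡ (e-refl i) ⟩
              A - 1ℚ + share u - 1ℚ * share u
                ≡⟨ solve 2 (λ a s → a :+ s :- con 1ℚ :* s := a) refl (A - 1ℚ) (share u) ⟩
              A - 1ℚ
                ≡⟨ σ-≤ ℕ.≤-refl ⟨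
              σ (toℕ i) ∎

      -- Kirchhoff's law at the junction after petal j: what arrives there is `c j` and, if j is i,
      -- the unit that `Θ u` delivers at `y`.
      σ-suc : ∀ j → σ (suc (toℕ j)) ≡ c j + e i j
      σ-suc j with ℕ.<-cmp (toℕ j) (toℕ i)
      ... | tri< j<i j≢i _ = begin
              σ (suc (toℕ j))   ≡⟨ σ-≤ j<i ⟩
              A - 1ℚ            ≡⟨ ℚ.+-identityʳ (A - 1ℚ) ⟨
              A - 1ℚ + 0ℚ       ≡⟨ cong₂ _+_ (trans (c-σ j) (σ-≤ (ℕ.<⇒≤ j<i))) (e-≢ (j≢i ∘ cong toℕ ∘ sym)) ⟨
              c j + e i j       ∎
      ... | tri> _ j≢i i<j = begin
              σ (suc (toℕ j))   ≡⟨ σ-> (ℕ.m<n⇒m<1+n i<j) ⟩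
              A                 ≡⟨ ℚ.+-identityʳ A ⟨
              A + 0ℚ            ≡⟨ cong₂ _+_ (trans (c-σ j) (σ-> i<j)) (e-≢ (j≢i ∘ cong toℕ ∘ sym)) ⟨
              c j + e i j       ∎
      ... | tri≈ _ j≡i _ with refl ← Fin.toℕ-injective j≡i = begin
              σ (suc (toℕ i))   ≡⟨ σ-> ℕ.≤-refl ⟩
              A                 ≡⟨ solve 1 (λ a → a := a :- con 1ℚ :+ con 1ℚ) refl A ⟩
              A - 1ℚ + 1ℚ       ≡⟨ cong₂ _+_ (trans (c-σ i) (σ-≤ ℕ.≤-refl)) (e-refl i) ⟨
              c i + e i i       ∎

      -- The potential for a unit current from vertex u of petal i to the
      -- vertex x of petal 0.
      K : Fin n → Fin (suc k) → ℚ
      K j v = (e i j * Θ u v + c j * Θ x v) + r * W (suc (toℕ j))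

      K-y : ∀ j → K j y ≡ r * W (suc (toℕ j))
      K-y j = begin
        e i j * Θ u y + c j * Θ x y + r * W (suc (toℕ j))
          ≡⟨ cong₂ (λ p q → e i j * p + c j * q + r * W (suc (toℕ j)))
               (Θ-y u) (Θ-y x) ⟩
        e i j * 0ℚ + c j * 0ℚ + r * W (suc (toℕ j))
          ≡⟨ solve 3 (λ a b c → a :* con 0ℚ :+ b :* con 0ℚ :+ c := c) refl (e i j) (c j) (r * W (suc (toℕ j))) ⟩
        r * W (suc (toℕ j)) ∎

      K-x : ∀ j → K j x ≡ r * W (toℕ j)
      K-x j = begin
        e i j * Θ u x + c j * Θ x x + r * W (suc (toℕ j))
          ≡⟨ cong (λ t → e i j * t + c j * r + r * W (suc (toℕ j)))
               (trans (Θ-sym G grounded u x) (sym (share-* u))) ⟩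
        e i j * (share u * r) + c j * r + r * W (suc (toℕ j))
          ≡⟨ solve 5 (λ d s r w w′ → d :* (s :* r) :+ (w :- w′ :- d :* s) :* r :+ r :* w′ := r :* w)
               refl (e i j) (share u) r (W (toℕ j)) (W (suc (toℕ j))) ⟩
        r * W (toℕ j) ∎

      -- The potential closes up around the cycle because `W` vanishes at both 0 and n.
      W-next : ∀ (j : Fin n) → W (toℕ (next j)) ≡ W (suc (toℕ j))
      W-next j with toℕ-next j
      ... | inj₁ eq         = cong W eq
      ... | inj₂ (eq , eq′) = begin
              W (toℕ (next j))    ≡⟨ cong W eq ⟩
              W 0                 ≡⟨ W-≤ {0} ℕ.z≤n ⟩
              0ℚ * (1ℚ - A)       ≡⟨ solve 2 (λ a n → con 0ℚ :* (con 1ℚ :- a) := a :* (n :- n)) refl A N ⟩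
              A * (N - N)         ≡⟨ W-> (Fin.toℕ<n i) ⟨
              W n                 ≡⟨ cong W eq′ ⟨
              W (suc (toℕ j))     ∎

      lift = glue-lift x≢y K λ j → trans (K-y j)
        (trans (cong (r *_) (sym (W-next j))) (sym (K-x (next j))))

      f = proj₁ lift
      f-glue = proj₂ lift

      K-laplacian : ∀ j → laplacian G ·ᵥ K j ≗
                    λ w → e i j * (e u w - e y w) + c j * (e x w - e y w)
      K-laplacian j w = begin
        L ∙ (λ v → (e i j * Θ u v + c j * Θ x v) + r * W (suc (toℕ j)))
          ≡⟨ ∙-distrib-+ L (λ v → e i j * Θ u v + c j * Θ x v) (λ _ → r * W (suc (toℕ j))) ⟩
        L ∙ (λ v → e i j * Θ u v + c j * Θ x v) + L ∙ (λ _ → r * W (suc (toℕ j)))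
          ≡⟨ cong₂ _+_ (∙-linear L (e i j) (Θ u) (c j) (Θ x)) (laplacian-const G (r * W (suc (toℕ j))) w) ⟩
        e i j * (L ∙ Θ u) + c j * (L ∙ Θ x) + 0ℚ
          ≡⟨ ℚ.+-identityʳ _ ⟩
        e i j * (L ∙ Θ u) + c j * (L ∙ Θ x)
          ≡⟨ cong₂ (λ p q → e i j * p + c j * q)
               (LΘ u w) (LΘ x w) ⟩
        e i j * (e u w - e y w) + c j * (e x w - e y w) ∎
        where L = laplacian G w

      -- Petal j contributes σ j at its `x` and - σ (j + 1) at its `y`, which is the `x` of the next
      -- petal, besides the unit source at `u`. The junction terms telescope, leaving only the seam
      -- at petal 0.
      f-laplacian : laplacian F ·ᵥ f ≗ λ p → e (g i u) p - e (g zero x) p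
      f-laplacian p = begin
        (laplacian F ·ᵥ f) p
          ≡⟨ flower-laplacian G x≢y n 3≤n f p ⟩
        ∑[ j < n ] (Z j ∙ (laplacian G ·ᵥ (f ∘ g j)))
          ≡⟨ sum-cong-≗ (λ j → begin
               Z j ∙ (laplacian G ·ᵥ (f ∘ g j))
                 ≡⟨ ∙-congˡ (Z j) (λ w → trans (∙-congˡ (laplacian G w) (f-glue j)) (K-laplacian j w)) ⟩
               Z j ∙ (λ w → e i j * (e u w - e y w) + c j * (e x w - e y w))
                 ≡⟨ ∙-linear (Z j) (e i j) (λ w → e u w - e y w) (c j) (λ w → e x w - e y w) ⟩
               e i j * (Z j ∙ (λ w → e u w - e y w)) + c j * (Z j ∙ (λ w → e x w - e y w))
                 ≡⟨ cong₂ (λ p q → e i j * p + c j * q) (Z-∙ j u) (Z-∙ j x) ⟩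
               e i j * (Z j u - Z j y) + c j * (Z j x - Z j y)
                 ≡⟨ solve 5 (λ d c u y x → d :* (u :- y) :+ c :* (x :- y) := d :* u :+ (c :* x :- (c :+ d) :* y))
                      refl (e i j) (c j) (Z j u) (Z j y) (Z j x) ⟩
               e i j * Z j u + (c j * Z j x - (c j + e i j) * Z j y)
                 ≡⟨ cong (e i j * Z j u +_) (cong₂ _-_
                      (cong₂ _*_ (c-σ j) (Zx j)) (cong₂ _*_ (sym (σ-suc j)) (Zy j))) ⟩
               e i j * Z j u + (V (toℕ j) - V (suc (toℕ j))) ∎) ⟩
        ∑[ j < n ] (e i j * Z j u + (V (toℕ j) - V (suc (toℕ j))))
          ≡⟨ ∑-distrib-+ (λ j → e i j * Z j u) (λ j → V (toℕ j) - V (suc (toℕ j))) ⟩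
        e i ∙ (λ j → Z j u) + ∑[ j < n ] (V (toℕ j) - V (suc (toℕ j)))
          ≡⟨ cong₂ _+_ (e-∙ i (λ j → Z j u)) (∑-telescope n V) ⟩
        e (g i u) p + (σ 0 * X 0 - σ n * X n)
          ≡⟨ cong (e (g i u) p +_) (cong₂ _-_
               (cong (_* X 0) (σ-≤ {0} ℕ.z≤n))
               (cong₂ _*_ (σ-> (Fin.toℕ<n i)) (cong (λ j → e (g j x) p) n-mod))) ⟩
        -- Over a full turn `σ` rises from A - 1 to A; this unit is the sink at `x` of petal 0.
        e (g i u) p + ((A - 1ℚ) * X 0 - A * X 0)
          ≡⟨ solve 3 (λ z a x → z :+ ((a :- con 1ℚ) :* x :- a :* x) := z :- x) refl (e (g i u) p) A (X 0) ⟩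
        e (g i u) p - e (g zero x) p ∎
        where
        Z : Fin n → Fin (suc k) → ℚ
        Z j w = e (g j w) p

        -- Petal indices are read modulo n, so that the telescoping sum can run over naturals up to
        -- n, where `X n` is `X 0` again.
        X V : ℕ → ℚ
        X b = e (g (b mod n) x) p
        V b = σ b * X b

        n-mod : n mod n ≡ zero
        n-mod = Fin.toℕ-injective (trans (Fin.toℕ-fromℕ< _) (n%n≡0 n))

        Z-∙ : ∀ j w → Z j ∙ (λ v → e w v - e y v) ≡ Z j w - Z j y
        Z-∙ j w = trans (∙-distrib-- (Z j) (e w) (e y)) (cong₂ _-_ (∙-e (Z j) w) (∙-e (Z j) y))

        Zx : ∀ j → Z j x ≡ X (toℕ j)
        Zx j = cong (λ j → e (g j x) p) (sym (Fin.toℕ-injective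
          (trans (Fin.toℕ-fromℕ< _) (m<n⇒m%n≡m (Fin.toℕ<n j)))))

        Zy : ∀ j → Z j y ≡ X (suc (toℕ j))
        Zy j = cong (λ q → e q p) (glue-y x≢y j)

      -- With b the position of the target, `f-after` and `f-before` give r (min(a,b) - ab/n), the
      -- Green's function of a segment of length n grounded at both ends. In the petal of the source
      -- the local term `Θ u v - r * share v` corrects it.
      f-same : ∀ v → f (g i v) ≡ Θ u v + r * (a - A * position i v - share v)
      f-same v = begin
        f (g i v)
          ≡⟨ f-glue i v ⟩
        e i i * Θ u v + c i * Θ x v + r * W (suc (toℕ i))
          ≡⟨ cong₂ (λ d w → d * Θ u v + c i * Θ x v + r * w) (e-refl i) (W-> ℕ.≤-refl) ⟩
        1ℚ * Θ u v + c i * Θ x v + r * (A * (N - (1ℚ + ι (toℕ i))))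
          ≡⟨ cong₂ (λ d w → 1ℚ * Θ u v + d * w + r * (A * (N - (1ℚ + ι (toℕ i)))))
               (trans (c-σ i) (σ-≤ ℕ.≤-refl)) (sym (share-* v)) ⟩
        1ℚ * Θ u v + (A - 1ℚ) * (share v * r) + r * (A * (N - (1ℚ + ι (toℕ i))))
          ≡⟨ solve 6 (λ t a s r n i →
               con 1ℚ :* t :+ (a :- con 1ℚ) :* (s :* r) :+ r :* (a :* (n :- (con 1ℚ :+ i)))
               := t :+ r :* (a :* n :- a :* (con 1ℚ :+ i :- s) :- s))
               refl (Θ u v) A (share v) r N (ι (toℕ i)) ⟩
        Θ u v + r * (A * N - A * position i v - share v)
          ≡⟨ cong (λ t → Θ u v + r * (t - A * position i v - share v)) A*N ⟩
        Θ u v + r * (a - A * position i v - share v) ∎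

      f-after : ∀ {j} → toℕ i ℕ.< toℕ j → ∀ v → f (g j v) ≡ r * (a - A * position j v)
      f-after {j} i<j v = begin
        f (g j v)
          ≡⟨ f-glue j v ⟩
        e i j * Θ u v + c j * Θ x v + r * W (suc (toℕ j))
          ≡⟨ cong₂ (λ d w → d * Θ u v + c j * Θ x v + r * w)
               (e-≢ (ℕ.<⇒≢ i<j ∘ cong toℕ)) (W-> (ℕ.m<n⇒m<1+n i<j)) ⟩
        0ℚ * Θ u v + c j * Θ x v + r * (A * (N - (1ℚ + ι (toℕ j))))
          ≡⟨ cong₂ (λ d w → 0ℚ * Θ u v + d * w + r * (A * (N - (1ℚ + ι (toℕ j)))))
               (trans (c-σ j) (σ-> i<j)) (sym (share-* v)) ⟩
        0ℚ * Θ u v + A * (share v * r) + r * (A * (N - (1ℚ + ι (toℕ j))))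
          ≡⟨ solve 6 (λ t a s r n i →
               con 0ℚ :* t :+ a :* (s :* r) :+ r :* (a :* (n :- (con 1ℚ :+ i)))
               := r :* (a :* n :- a :* (con 1ℚ :+ i :- s)))
               refl (Θ u v) A (share v) r N (ι (toℕ j)) ⟩
        r * (A * N - A * position j v)
          ≡⟨ cong (λ t → r * (t - A * position j v)) A*N ⟩
        r * (a - A * position j v) ∎

      f-before : ∀ {j} → toℕ j ℕ.< toℕ i → ∀ v → f (g j v) ≡ r * (position j v - A * position j v)
      f-before {j} j<i v = begin
        f (g j v)
          ≡⟨ f-glue j v ⟩
        e i j * Θ u v + c j * Θ x v + r * W (suc (toℕ j))
          ≡⟨ cong₂ (λ d w → d * Θ u v + c j * Θ x v + r * w)
               (e-≢ (ℕ.>⇒≢ j<i ∘ cong toℕ)) (W-≤ j<i) ⟩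
        0ℚ * Θ u v + c j * Θ x v + r * ((1ℚ + ι (toℕ j)) * (1ℚ - A))
          ≡⟨ cong₂ (λ d w → 0ℚ * Θ u v + d * w + r * ((1ℚ + ι (toℕ j)) * (1ℚ - A)))
               (trans (c-σ j) (σ-≤ (ℕ.<⇒≤ j<i))) (sym (share-* v)) ⟩
        0ℚ * Θ u v + (A - 1ℚ) * (share v * r) + r * ((1ℚ + ι (toℕ j)) * (1ℚ - A))
          ≡⟨ solve 5 (λ t a s r i →
               con 0ℚ :* t :+ (a :- con 1ℚ) :* (s :* r) :+ r :* ((con 1ℚ :+ i) :* (con 1ℚ :- a))
               := r :* ((con 1ℚ :+ i :- s) :- a :* (con 1ℚ :+ i :- s)))
               refl (Θ u v) A (share v) r (ι (toℕ j)) ⟩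
        r * (position j v - A * position j v) ∎

  -- The two potentials drain at the same vertex, so the sinks cancel in their difference.
  flower-resistance-green : ∀ i u j v → resistance F (g i u) (g j v) ≡
    (P.f i u (g i u) - P.f j v (g i u)) - (P.f i u (g j v) - P.f j v (g j v))
  flower-resistance-green i u j v =
    resistance-potential F (λ p → P.f i u p - P.f j v p) λ p → begin
      (laplacian F ·ᵥ (λ p → P.f i u p - P.f j v p)) p
        ≡⟨ ∙-distrib-- (laplacian F p) (P.f i u) (P.f j v) ⟩
      (laplacian F ·ᵥ P.f i u) p - (laplacian F ·ᵥ P.f j v) p
        ≡⟨ cong₂ _-_ (P.f-laplacian i u p) (P.f-laplacian j v p) ⟩
      (e (g i u) p - e (g zero x) p) - (e (g j v) p - e (g zero x) p)
        ≡⟨ solve 3 (λ p q r → (p :- q) :- (r :- q) := p :- r) refl (e (g i u) p) (e (g zero x) p) (e (g j v) p) ⟩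
      e (g i u) p - e (g j v) p ∎

  -- The last term is rδ (n - δ) / n, two arcs of resistances rδ and r(n - δ) in parallel. The legs
  -- of the two stars are in series with it.
  resistance-distinct : ∀ i u j v → toℕ i ℕ.< toℕ j → let δ = position j v - position i u in
    resistance F (g i u) (g j v) ≡ height grounded x u + height grounded x v + r * (δ - ν * (δ * δ))
  resistance-distinct i u j v i<j = begin
    resistance F (g i u) (g j v)
      ≡⟨ flower-resistance-green i u j v ⟩
    (P.f i u (g i u) - P.f j v (g i u)) - (P.f i u (g j v) - P.f j v (g j v))
      ≡⟨ cong₂ _-_ (cong₂ _-_ (P.f-same i u u) (P.f-before j v i<j u))
                   (cong₂ _-_ (P.f-after i u i<j v) (P.f-same j v v)) ⟩
    (Θ u u + r * (a - a * ν * a - share u) - r * (a - b * ν * a))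
      - (r * (a - a * ν * b) - (Θ v v + r * (b - b * ν * b - share v)))
      ≡⟨ solve 8 (λ uu vv r a b ν s t →
           (uu :+ r :* (a :- a :* ν :* a :- s) :- r :* (a :- b :* ν :* a))
             :- (r :* (a :- a :* ν :* b) :- (vv :+ r :* (b :- b :* ν :* b :- t)))
           := (uu :- s :* r) :+ (vv :- t :* r) :+ r :* ((b :- a) :- ν :* ((b :- a) :* (b :- a))))
           refl (Θ u u) (Θ v v) r a b ν (share u) (share v) ⟩
    (Θ u u - share u * r) + (Θ v v - share v * r) + r * ((b - a) - ν * ((b - a) * (b - a)))
      ≡⟨ cong₂ (λ p q → (Θ u u - p) + (Θ v v - q) + r * ((b - a) - ν * ((b - a) * (b - a))))
           (share-* u) (share-* v) ⟩
    height grounded x u + height grounded x v + r * ((b - a) - ν * ((b - a) * (b - a))) ∎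
    where
    a = position i u
    b = position j v

  -- The other petals form a second path between the ends of petal i, which lowers the resistance by
  -- rδ²/n.
  resistance-same : ∀ i u v → let δ = position i v - position i u in
    resistance F (g i u) (g i v) ≡ resistance G u v - r * (ν * (δ * δ))
  resistance-same i u v = begin
    resistance F (g i u) (g i v)
      ≡⟨ flower-resistance-green i u i v ⟩
    (P.f i u (g i u) - P.f i v (g i u)) - (P.f i u (g i v) - P.f i v (g i v))
      ≡⟨ cong₂ _-_ (cong₂ _-_ (P.f-same i u u) (P.f-same i v u))
                   (cong₂ _-_ (P.f-same i u v) (P.f-same i v v)) ⟩
    (Θ u u + r * (a - a * ν * a - share u) - (Θ v u + r * (b - b * ν * a - share u)))
      - (Θ u v + r * (a - a * ν * b - share v) - (Θ v v + r * (b - b * ν * b - share v)))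
      ≡⟨ solve 10 (λ uu vu uv vv r a b ν s t →
           (uu :+ r :* (a :- a :* ν :* a :- s) :- (vu :+ r :* (b :- b :* ν :* a :- s)))
             :- (uv :+ r :* (a :- a :* ν :* b :- t) :- (vv :+ r :* (b :- b :* ν :* b :- t)))
           := ((uu :- vu) :- (uv :- vv)) :- r :* (ν :* ((b :- a) :* (b :- a))))
           refl (Θ u u) (Θ v u) (Θ u v) (Θ v v) r a b ν (share u) (share v) ⟩
    ((Θ u u - Θ v u) - (Θ u v - Θ v v)) - r * (ν * ((b - a) * (b - a)))
      ≡⟨ cong (_- r * (ν * ((b - a) * (b - a)))) (resistance-grounded G grounded u v) ⟨
    resistance G u v - r * (ν * ((b - a) * (b - a))) ∎
    where
    a = position i u
    b = position i v

  flower-resistance-sym : ∀ i u j v →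
    resistance F (g i u) (g j v) ≡ resistance F (g j v) (g i u)
  flower-resistance-sym i u j v = begin
    resistance F (g i u) (g j v)
      ≡⟨ flower-resistance-green i u j v ⟩
    (P.f i u (g i u) - P.f j v (g i u)) - (P.f i u (g j v) - P.f j v (g j v))
      ≡⟨ solve 4 (λ p q r s → (p :- q) :- (r :- s) := (s :- r) :- (q :- p)) refl
           (P.f i u (g i u)) (P.f j v (g i u)) (P.f i u (g j v)) (P.f j v (g j v)) ⟩
    (P.f j v (g j v) - P.f i u (g j v)) - (P.f j v (g i u) - P.f i u (g i u))
      ≡⟨ flower-resistance-green j v i u ⟨
    resistance F (g j v) (g i u) ∎

-- Rational estimates

argmax : ∀ {n} (f : Fin (suc n) → ℚ) → ∃ λ i → ∀ j → f j ≤ f i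
argmax {zero}  f = zero , λ { zero → ℚ.≤-refl }
argmax {suc n} f with i , f≤ ← argmax (f ∘ suc) with ℚ.≤-total (f zero) (f (suc i))
... | inj₁ f0≤ = suc i , λ { zero → f0≤ ; (suc j) → f≤ j }
... | inj₂ ≤f0 = zero , λ { zero → ℚ.≤-refl ; (suc j) → ℚ.≤-trans (f≤ j) ≤f0 }

module _ where
  open Data.Rational.Base using (_+_)

  ι-+ : ∀ m n → ι (m ℕ.+ n) ≡ ι m + ι n
  ι-+ zero    n = sym (ℚ.+-identityˡ (ι n))
  ι-+ (suc m) n = trans (cong (1ℚ +_) (ι-+ m n)) (sym (ℚ.+-assoc 1ℚ (ι m) (ι n)))

  0≤1 : 0ℚ ≤ 1ℚ
  0≤1 = ℚ.nonNegative⁻¹ 1ℚ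

  ι-nonneg : ∀ n → 0ℚ ≤ ι n
  ι-nonneg zero    = ℚ.≤-refl
  ι-nonneg (suc n) = ℚ.+-mono-≤ 0≤1 (ι-nonneg n)

  ι-pos : ∀ n → 0ℚ < ι (suc n)
  ι-pos n = ℚ.+-mono-<-≤ (ℚ.positive⁻¹ 1ℚ) (ι-nonneg n)

  ι-mono : ∀ {m n} → m ℕ.≤ n → ι m ≤ ι n
  ι-mono {n = n} ℕ.z≤n = ι-nonneg n
  ι-mono (ℕ.s≤s m≤n)   = ℚ.+-monoʳ-≤ 1ℚ (ι-mono m≤n)

  toℚᵘ-ι : ∀ n → toℚᵘ (ι n) ℚᵘ.≃ mkℚᵘ (ℤ.+ n) 0
  toℚᵘ-ι zero    = ℚᵘ.≃-refl
  toℚᵘ-ι (suc n) = ℚᵘ.≃-trans (ℚ.toℚᵘ-homo-+ 1ℚ (ι n))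
    (ℚᵘ.≃-trans (ℚᵘ.+-congʳ (mkℚᵘ (ℤ.+ 1) 0) (toℚᵘ-ι n))
      (ℚᵘ.≃-reflexive (cong (λ i → mkℚᵘ (ℤ.+ 1 ℤ.+ i) 0) (ℤ.*-identityʳ (ℤ.+ n)))))

  -- A nonnegative fraction is at most its numerator, and a negative one is at most 0.
  ≤-ι : ∀ q → ∃ λ n → q ≤ ι n
  ≤-ι (mkℚ (ℤ.+ m) d c)      = m , ℚ.toℚᵘ-cancel-≤ (ℚᵘ.≤-respʳ-≃ (ℚᵘ.≃-sym (toℚᵘ-ι m))
    (ℚᵘ.*≤* (ℤ.*-monoˡ-≤-nonNeg (ℤ.+ m) (ℤ.+≤+ (ℕ.s≤s ℕ.z≤n)))))
  ≤-ι q@(mkℚ -[1+ _ ] _ _) = 0 , ℚ.<⇒≤ (ℚ.negative⁻¹ q)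

  reciprocal : ∀ {p} → 0ℚ < p → ∃ λ q → 0ℚ < q × q * p ≡ 1ℚ
  reciprocal {p} 0<p = 1/ p , ℚ.positive⁻¹ (1/ p) {{ℚ.1/pos⇒pos p}} , ℚ.*-inverseˡ p
    where
    instance
      p-pos = positive 0<p
      p-nonZero = ℚ.pos⇒nonZero p

  archimedean : ∀ {r} → 0ℚ < r → ∀ c → ∃ λ K → ∀ n → K ℕ.≤ n → c ≤ r * ι n
  archimedean {r} 0<r c =
    let q , 0<q , q*r≡1 = reciprocal 0<r
        K , qc≤K        = ≤-ι (q * c)
    in K , λ n K≤n → subst (_≤ r * ι n)
      (begin
        r * (q * c)   ≡⟨ solve 3 (λ r q c → r :* (q :* c) := (q :* r) :* c) refl r q c ⟩
        q * r * c     ≡⟨ cong (_* c) q*r≡1 ⟩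
        1ℚ * c        ≡⟨ ℚ.*-identityˡ c ⟩
        c             ∎)
      (ℚ.*-monoˡ-≤-nonNeg r {{nonNegative (ℚ.<⇒≤ 0<r)}} (ℚ.≤-trans qc≤K (ι-mono K≤n)))

  diff-≤ : ∀ {p q} → 0ℚ ≤ q - p → p ≤ q
  diff-≤ {p} {q} 0≤q-p = subst₂ _≤_ (ℚ.+-identityˡ p)
    (solve 2 (λ p q → q :- p :+ p := q) refl p q) (ℚ.+-monoˡ-≤ p 0≤q-p)

  ≤-diff : ∀ {p q} → p ≤ q → 0ℚ ≤ q - p
  ≤-diff {p} {q} p≤q = subst (_≤ q - p) (ℚ.+-inverseʳ p) (ℚ.+-monoˡ-≤ (- p) p≤q)

  *-nonneg : ∀ {p q} → 0ℚ ≤ p → 0ℚ ≤ q → 0ℚ ≤ p * q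
  *-nonneg {p} {q} 0≤p 0≤q = subst (_≤ p * q) (ℚ.*-zeroʳ p)
    (ℚ.*-monoˡ-≤-nonNeg p {{nonNegative 0≤p}} 0≤q)

  ¼ ½ : ℚ
  ¼ = ℤ.+ 1 / 4
  ½ = ℤ.+ 1 / 2

  private
    deviation : ℚ → ℚ → ℚ
    deviation N δ = (δ - ½ * N) * (δ - ½ * N)

  parabola : ∀ ν N → ν * N ≡ 1ℚ → ∀ δ → δ - ν * (δ * δ) ≡ ¼ * N - ν * deviation N δ
  parabola ν N ν*N≡1 δ = begin
    δ - ν * (δ * δ)
      -- Factors of 1 are inserted for the hypothesis to replace by `ν * N`; what remains is
      -- completing the square.
      ≡⟨ solve 3 (λ ν N δ → δ :- ν :* (δ :* δ) :=
           con 1ℚ :* δ :+ con ¼ :* (N :- con 1ℚ :* N) :- ν :* (δ :* δ)) refl ν N δ ⟩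
    1ℚ * δ + ¼ * (N - 1ℚ * N) - ν * (δ * δ)
      ≡⟨ cong (λ t → t * δ + ¼ * (N - t * N) - ν * (δ * δ)) ν*N≡1 ⟨
    ν * N * δ + ¼ * (N - ν * N * N) - ν * (δ * δ)
      ≡⟨ solve 3 (λ ν N δ → (ν :* N) :* δ :+ con ¼ :* (N :- (ν :* N) :* N) :- ν :* (δ :* δ) :=
           con ¼ :* N :- ν :* ((δ :- con ½ :* N) :* (δ :- con ½ :* N))) refl ν N δ ⟩
    ¼ * N - ν * deviation N δ ∎

  parabola-≤ : ∀ ν N → 0ℚ ≤ ν → ν * N ≡ 1ℚ → ∀ δ → δ - ν * (δ * δ) ≤ ¼ * N
  parabola-≤ ν N 0≤ν ν*N≡1 δ = diff-≤ (subst (0ℚ ≤_) (begin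
    ν * deviation N δ
      ≡⟨ solve 2 (λ a b → b := a :- (a :- b)) refl (¼ * N) (ν * deviation N δ) ⟩
    ¼ * N - (¼ * N - ν * deviation N δ)
      ≡⟨ cong (λ t → ¼ * N - t) (parabola ν N ν*N≡1 δ) ⟨
    ¼ * N - (δ - ν * (δ * δ)) ∎)
    (*-nonneg 0≤ν (square-nonneg (δ - ½ * N))))

  parabola-≥ : ∀ ν N → 0ℚ ≤ ν → ν * N ≡ 1ℚ → ∀ δ → deviation N δ ≤ 1ℚ →
               ¼ * N - ν ≤ δ - ν * (δ * δ)
  parabola-≥ ν N 0≤ν ν*N≡1 δ small = diff-≤ (subst (0ℚ ≤_) (begin
    ν * (1ℚ - deviation N δ)
      ≡⟨ solve 3 (λ a ν d → ν :* (con 1ℚ :- d) := a :- ν :* d :- (a :- ν)) refl (¼ * N) ν (deviation N δ) ⟩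
    ¼ * N - ν * deviation N δ - (¼ * N - ν)
      ≡⟨ cong (_- (¼ * N - ν)) (parabola ν N ν*N≡1 δ) ⟨
    δ - ν * (δ * δ) - (¼ * N - ν) ∎)
    (*-nonneg 0≤ν (≤-diff small)))

  -- The witness is n/2 rounded down. Raising n by 2 and d by 1 preserves the deviation, which is 0
  -- for n = 2 and 1/4 for n = 3.
  halve : ∀ n → 2 ℕ.≤ n → ∃ λ d → 0 ℕ.< d × d ℕ.< n × deviation (ι n) (ι d) ≤ 1ℚ
  halve 1 (ℕ.s≤s ())
  halve 2 _ = 1 , ℕ.s≤s ℕ.z≤n , ℕ.s≤s (ℕ.s≤s ℕ.z≤n) , 0≤1
  halve 3 _ = 1 , ℕ.s≤s ℕ.z≤n , ℕ.s≤s (ℕ.s≤s ℕ.z≤n) , toWitness {a? = ¼ ℚ.≤? 1ℚ} _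
  halve (suc (suc n@(suc (suc _)))) _ =
    let d , 0<d , d<n , small = halve n (ℕ.s≤s (ℕ.s≤s ℕ.z≤n))
    in suc d , ℕ.s≤s ℕ.z≤n , ℕ.s≤s (ℕ.m<n⇒m<1+n d<n) , subst (_≤ 1ℚ)
      (solve 2 (λ n d → (d :- con ½ :* n) :* (d :- con ½ :* n) :=
        (con 1ℚ :+ d :- con ½ :* (con 1ℚ :+ (con 1ℚ :+ n))) :* (con 1ℚ :+ d :- con ½ :* (con 1ℚ :+ (con 1ℚ :+ n))))
        refl (ι n) (ι d))
      small

  -- For large m, M m lies within r/n below a linear function of n = 3 + m with slope r/4, so its
  -- increments differ from r/4 by at most an error of order 1/n. The condition on `B` in the upper
  -- bound holds eventually.
  increment-limit : ∀ (M : ℕ → ℚ) (h r B : ℚ) → 0ℚ < r →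
    (∀ m → B ≤ h + ¼ * r * ι (3 ℕ.+ m) → M m ≤ h + ¼ * r * ι (3 ℕ.+ m)) →
    (∀ m ν → 0ℚ ≤ ν → ν * ι (3 ℕ.+ m) ≡ 1ℚ → h + ¼ * r * ι (3 ℕ.+ m) - r * ν ≤ M m) →
    (λ m → M (suc m) - M m) ⟶ ¼ * r
  increment-limit M h r B 0<r upper lower ε 0<ε = K , λ m K≤m →
    let K≤m+1 = ℕ.m≤n⇒m≤1+n K≤m in
    ∣∣<-intro
      -- The increment is bounded below by `bottom` at `suc m` and `top` at `m`, and above with
      -- these two exchanged.
      (ℚ.<-≤-trans (ℚ.neg-antimono-< (proj₁ (proj₂ (small (suc m) K≤m+1)))) (diff-≤ (subst (0ℚ ≤_)
        (solve 6 (λ s q r e x y → (x :- (s :- e)) :+ (s :- q :- y) := x :- y :- q :- :- e)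
           refl (S (suc m)) (¼ * r) r (gap (suc m) K≤m+1) (M (suc m)) (M m))
        (ℚ.+-mono-≤ (≤-diff (bottom (suc m) K≤m+1))
          (≤-diff (subst (M m ≤_) (S-suc m) (top m K≤m)))))))
      (ℚ.≤-<-trans (diff-≤ (subst (0ℚ ≤_)
        (solve 5 (λ s q e x y → (s :+ q :- x) :+ (y :- (s :- e)) := e :- (x :- y :- q))
           refl (S m) (¼ * r) (gap m K≤m) (M (suc m)) (M m))
        (ℚ.+-mono-≤ (≤-diff (subst (M (suc m) ≤_) (S-suc′ m) (top (suc m) K≤m+1)))
          (≤-diff (bottom m K≤m)))))
        (proj₁ (proj₂ (small m K≤m))))
    where
    S : ℕ → ℚ
    S m = h + ¼ * r * ι (3 ℕ.+ m)

    S-suc′ : ∀ m → S (suc m) ≡ S m + ¼ * r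
    S-suc′ m = solve 3 (λ h q n → h :+ q :* (con 1ℚ :+ n) := h :+ q :* n :+ q)
      refl h (¼ * r) (ι (3 ℕ.+ m))

    S-suc : ∀ m → S m ≡ S (suc m) - ¼ * r
    S-suc m = trans (solve 2 (λ s q → s := s :+ q :- q) refl (S m) (¼ * r))
      (cong (_- ¼ * r) (sym (S-suc′ m)))

    -- From `K₁` on the condition on `B` holds. From `K₂` on 1 + r ≤ ε n, where the extra 1 makes
    -- r/n < ε strict.
    K₁ = archimedean {¼ * r} (ℚ.positive⁻¹ (¼ * r) {{ℚ.pos*pos⇒pos ¼ r {{positive 0<r}}}}) (B - h)
    K₂ = archimedean 0<ε (1ℚ + r)
    K = proj₁ K₁ ℕ.⊔ proj₁ K₂

    top : ∀ m → K ℕ.≤ m → M m ≤ S m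
    top m K≤m = upper m (diff-≤ (subst (0ℚ ≤_)
      (solve 3 (λ t b h → t :- (b :- h) := h :+ t :- b) refl (¼ * r * ι (3 ℕ.+ m)) B h)
      (≤-diff (proj₂ K₁ (3 ℕ.+ m) (ℕ.≤-trans (ℕ.m⊔n≤o⇒m≤o _ _ K≤m) (ℕ.m≤n+m m 3))))))

    small : ∀ m → K ℕ.≤ m → ∃ λ ν → (r * ν < ε) × (0ℚ ≤ ν × ν * ι (3 ℕ.+ m) ≡ 1ℚ)
    small m K≤m with ν , 0<ν , ν*N≡1 ← reciprocal (ι-pos (2 ℕ.+ m)) =
      ν , subst (r * ν <_)
        (trans (solve 3 (λ e n ν → e :* n :* ν := e :* (ν :* n)) refl ε (ι (3 ℕ.+ m)) ν)
          (trans (cong (ε *_) ν*N≡1) (ℚ.*-identityʳ ε)))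
        (ℚ.*-monoˡ-<-pos ν {{positive 0<ν}}
          (ℚ.<-≤-trans (subst (_< 1ℚ + r) (ℚ.+-identityˡ r) (ℚ.+-monoˡ-< r (ℚ.positive⁻¹ 1ℚ)))
            (proj₂ K₂ (3 ℕ.+ m) (ℕ.≤-trans (ℕ.m⊔n≤o⇒n≤o (proj₁ K₁) _ K≤m) (ℕ.m≤n+m m 3)))))
        , ℚ.<⇒≤ 0<ν , ν*N≡1

    gap : ∀ m → K ℕ.≤ m → ℚ
    gap m K≤m = r * proj₁ (small m K≤m)

    bottom : ∀ m K≤m → S m - gap m K≤m ≤ M m
    bottom m K≤m = let ν , _ , 0≤ν , ν*N≡1 = small m K≤m in lower m ν 0≤ν ν*N≡1

    ∣∣<-intro : ∀ {p} → - ε < p → p < ε → ∣ p ∣ < ε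
    ∣∣<-intro {p} -ε<p p<ε with ℚ.∣p∣≡p∨∣p∣≡-p p
    ... | inj₁ eq = subst (_< ε) (sym eq) p<ε
    ... | inj₂ eq = subst₂ _<_ (sym eq) (solve 1 (λ e → :- (:- e) := e) refl ε) (ℚ.neg-antimono-< -ε<p)

-- The maximal resistance

module _ {k} (G : Graph (suc k)) {x y : Fin (suc k)} (x≢y : x ≢ y)
  (grounded : Grounded G y) (0<r : 0ℚ < Grounded.Θ grounded x x)
  (n₁ : ℕ) (3≤n : 3 ℕ.≤ suc n₁)
  (ν : ℚ) (0≤ν : 0ℚ ≤ ν) (ν-inverse : ν * ι (suc n₁) ≡ 1ℚ)
  where
  open Data.Rational.Base using (_+_)
  open FlowerResistance G x≢y grounded (ℚ.<⇒≢ 0<r ∘ sym) n₁ 3≤n ν ν-inverse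

  private
    r = Grounded.Θ grounded x x
    n = suc n₁
    F = flower G x≢y n 3≤n
    N = ι n
    g : Fin n → Fin (suc k) → Fin (n ℕ.* k)
    g = glue x≢y
    height′ = height grounded x

    instance
      r-nonNeg = nonNegative (ℚ.<⇒≤ 0<r)

  -- A pair attaining the maximum lies either in distinct petals, where heights and parabola bound
  -- it, or in one petal, where the resistance is at most that in `G` and `large` applies.
  maxResistance-≤ : ∀ {h} → (∀ u → height′ u ≤ h) →
    maxResistance G ≤ h + h + r * (¼ * N) → maxResistance F ≤ h + h + r * (¼ * N)
  maxResistance-≤ {h} height≤h large
    -- `max-attained` asks for a vertex at which the default value 0 is a resistance.
    = let p , q , eq   = max-attained F (g zero x)
          i , u , p≡   = glue-surjective x≢y p
          j , v , q≡   = glue-surjective x≢y q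
      in ℚ.≤-trans (ℚ.≤-reflexive (sym (trans (cong₂ (resistance F) p≡ q≡) eq)))
           (bound i u j v (ℕ.<-cmp (toℕ i) (toℕ j)))
    where
    distinct : ∀ i u j v → toℕ i ℕ.< toℕ j →
               resistance F (g i u) (g j v) ≤ h + h + r * (¼ * N)
    distinct i u j v i<j = ℚ.≤-trans (ℚ.≤-reflexive (resistance-distinct i u j v i<j))
      (ℚ.+-mono-≤ (ℚ.+-mono-≤ (height≤h u) (height≤h v))
        (ℚ.*-monoˡ-≤-nonNeg r (parabola-≤ ν N 0≤ν ν-inverse (position j v - position i u))))

    same : ∀ i u v → resistance F (g i u) (g i v) ≤ h + h + r * (¼ * N)
    same i u v =
          ℚ.≤-trans (diff-≤ (subst (0ℚ ≤_) (begin
            r * (ν * (δ * δ))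
              ≡⟨ solve 2 (λ a b → b := a :- (a :- b)) refl (resistance G u v) (r * (ν * (δ * δ))) ⟩
            resistance G u v - (resistance G u v - r * (ν * (δ * δ)))
              ≡⟨ cong (λ t → resistance G u v - t) (resistance-same i u v) ⟨
            resistance G u v - resistance F (g i u) (g i v) ∎)
            (*-nonneg (ℚ.<⇒≤ 0<r) (*-nonneg 0≤ν (square-nonneg δ)))))
          (ℚ.≤-trans (resistance≤max G u v) large)
      where δ = position i v - position i u

    bound : ∀ i u j v → Tri (toℕ i ℕ.< toℕ j) (toℕ i ≡ toℕ j) (toℕ j ℕ.< toℕ i) →
            resistance F (g i u) (g j v) ≤ h + h + r * (¼ * N)
    bound i u j v (tri< i<j _ _) = distinct i u j v i<j
    bound i u j v (tri> _ _ j<i) =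
      ℚ.≤-trans (ℚ.≤-reflexive (flower-resistance-sym i u j v)) (distinct j v i u j<i)
    bound i u j v (tri≈ _ i≡j _) =
      subst (λ j → resistance F (g i u) (g j v) ≤ h + h + r * (¼ * N))
        (Fin.toℕ-injective i≡j) (same i u v)

  -- The pair consists of the copies of `u` in petal 0 and in the opposite petal. Their shares
  -- cancel, so their distance on the circle is the integer d.
  ≤-maxResistance : ∀ u → height′ u + height′ u + r * (¼ * N - ν) ≤ maxResistance F
  ≤-maxResistance u =
    ℚ.≤-trans
      (ℚ.≤-trans
        (ℚ.+-monoʳ-≤ (height′ u + height′ u)
          (ℚ.*-monoˡ-≤-nonNeg r (parabola-≥ ν N 0≤ν ν-inverse (ι d) small)))
        (ℚ.≤-reflexive (begin
          height′ u + height′ u + r * (ι d - ν * (ι d * ι d))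
            ≡⟨ cong (λ t → height′ u + height′ u + r * (t - ν * (t * t))) δ≡d ⟨
          height′ u + height′ u + r * (δ - ν * (δ * δ))
            ≡⟨ resistance-distinct zero u j u (subst (0 ℕ.<_) (sym (Fin.toℕ-fromℕ< d<n)) 0<d) ⟨
          resistance F (g zero u) (g j u) ∎)))
      (resistance≤max F (g zero u) (g j u))
    where
    half = halve n (ℕ.≤-trans (ℕ.n≤1+n 2) 3≤n)
    d = proj₁ half
    0<d = proj₁ (proj₂ half)
    d<n = proj₁ (proj₂ (proj₂ half))
    small = proj₂ (proj₂ (proj₂ half))
    j = Fin.fromℕ< d<n
    δ = position j u - position zero u

    δ≡d : δ ≡ ι d
    δ≡d = trans
      (solve 2 (λ d s → (con 1ℚ :+ d :- s) :- (con 1ℚ :+ con 0ℚ :- s) := d) refl (ι (toℕ j)) (share u))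
      (cong ι (Fin.toℕ-fromℕ< d<n))

-- Limit of the increments of the maximal resistance.

module _ {k} (G : Graph (suc k)) (connected : Connected G) {x y : Fin (suc k)} (x≢y : x ≢ y) where
  open Data.Rational.Base using (_+_)

  private
    M : ℕ → ℚ
    M m = maxResistance (flower G x≢y (3 ℕ.+ m) (ℕ.m≤m+n 3 m))

  -- Both ends of a pair may be copies of one highest vertex, so the upper and the lower bound share
  -- the constant h + h with h the greatest height.
  grounded-limit : (grounded : Grounded G y) →
                   (λ m → M (suc m) - M m) ⟶ ¼ * Grounded.Θ grounded x x
  grounded-limit grounded = increment-limit M (h + h) r (maxResistance G) 0<r upper lower
    where
    r = Grounded.Θ grounded x x
    0<r = Θ-pos G grounded connected x≢y
    top = argmax (height grounded x)
    h = height grounded x (proj₁ top)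

    peak : ∀ m → h + h + r * (¼ * ι (3 ℕ.+ m)) ≡ h + h + ¼ * r * ι (3 ℕ.+ m)
    peak m = solve 4 (λ h q r n → h :+ h :+ r :* (q :* n) := h :+ h :+ q :* r :* n) refl h ¼ r (ι (3 ℕ.+ m))

    upper : ∀ m → maxResistance G ≤ h + h + ¼ * r * ι (3 ℕ.+ m) → M m ≤ h + h + ¼ * r * ι (3 ℕ.+ m)
    upper m large = let ν , 0<ν , ν*N≡1 = reciprocal (ι-pos (2 ℕ.+ m)) in
      subst (M m ≤_) (peak m)
        (maxResistance-≤ G x≢y grounded 0<r (2 ℕ.+ m) (ℕ.m≤m+n 3 m) ν (ℚ.<⇒≤ 0<ν) ν*N≡1
          (proj₂ top) (subst (maxResistance G ≤_) (sym (peak m)) large))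

    lower : ∀ m ν → 0ℚ ≤ ν → ν * ι (3 ℕ.+ m) ≡ 1ℚ → h + h + ¼ * r * ι (3 ℕ.+ m) - r * ν ≤ M m
    lower m ν 0≤ν ν*N≡1 = subst (_≤ M m)
      (solve 5 (λ h q r n ν → h :+ h :+ r :* (q :* n :- ν) := h :+ h :+ q :* r :* n :- r :* ν)
        refl h ¼ r (ι (3 ℕ.+ m)) ν)
      (≤-maxResistance G x≢y grounded 0<r (2 ℕ.+ m) (ℕ.m≤m+n 3 m) ν 0≤ν ν*N≡1 (proj₁ top))

open import Data.Integer.Base using (+_)
open import Data.Nat.Base using (_+_)
open import Data.Nat.Properties using (m≤m+n)

theorem3p5 : ∀ {k} (G : Graph (suc k)) → Connected G →
    {x y : Fin (suc k)} (x≢y : x ≢ y) →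
    let M : ℕ → ℚ
        M m = maxResistance (flower G x≢y (3 + m) (m≤m+n 3 m))
    in (λ m → M (suc m) - M m) ⟶ (+ 1 / 4) * resistance G x y
theorem3p5 G connected {x} {y} x≢y =
  subst (λ r → (λ m → M (suc m) - M m) ⟶ ¼ * r) (sym (resistance-ground G grounded x))
    (grounded-limit G connected x≢y grounded)
  where
  M : ℕ → ℚ
  M m = maxResistance (flower G x≢y (3 + m) (m≤m+n 3 m))

  grounded = ground G connected y
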